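{- Let $G$ be a $3$-connected graph in $\mathcal{G}_2$ in which every $3$-cutset is a stable set. If $G$ is not isomorphic to the Petersen graph, then $G$ has no induced subgraph isomorphic to $\theta^+$.
   Context: All graphs are finite and simple. A hole is an induced cycle of length at least $4$; an odd hole is a hole of odd length. $\mathcal{G}_2$ is the family of graphs of girth exactly $5$ having no odd holes of length at least $7$. A $3$-cutset is a set of $3$ vertices whose removal disconnects the graph; a set is stable if it induces no edges. $\theta^+$ is the graph obtained from the Petersen graph by deleting two adjacent vertices; equivalently, the graph on vertices $v_0,\ldots,v_7$ consisting of the $8$-cycle $v_0v_1\cdots v_7v_0$ together with the chords $v_0v_4$ and $v_2v_6$. -}

module Defs where

open import Data.Nat using (ℕ; zero; suc; _≡ᵇ_; _%_; _≤_; _<_)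
open import Data.Nat.Properties using ()
open import Data.Fin using (Fin; toℕ)
open import Data.Fin.Subset using (Subset; _∈_; _∉_; ∣_∣)
open import Data.Bool using (Bool; true; false; _∨_; _∧_)
open import Data.List using (List; []; _∷_)
open import Data.Product using (Σ; _×_; _,_; ∃)
open import Relation.Binary.PropositionalEquality using (_≡_; refl)
open import Relation.Nullary using (¬_)
open import Function.Definitions using (Injective; Bijective)

record Graph (n : ℕ) : Set where
  field
    adj   : Fin n → Fin n → Bool
    sym   : ∀ i j → adj i j ≡ adj j i
    irrefl : ∀ i → adj i i ≡ false
open Graph public

edgeAdj : {n : ℕ} → List (ℕ × ℕ) → Fin n → Fin n → Bool
edgeAdj [] i j = false
edgeAdj ((a , b) ∷ es) i j =
  (((a ≡ᵇ toℕ i) ∧ (b ≡ᵇ toℕ j)) ∨ ((a ≡ᵇ toℕ j) ∧ (b ≡ᵇ toℕ i))) ∨ edgeAdj es i j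

petersenEdges : List (ℕ × ℕ)
petersenEdges =
  -- outer 5-cycle
  (0 , 1) ∷ (1 , 2) ∷ (2 , 3) ∷ (3 , 4) ∷ (4 , 0) ∷
  -- spokes
  (0 , 5) ∷ (1 , 6) ∷ (2 , 7) ∷ (3 , 8) ∷ (4 , 9) ∷
  -- inner pentagram
  (5 , 7) ∷ (7 , 9) ∷ (9 , 6) ∷ (6 , 8) ∷ (8 , 5) ∷ []

-- θ⁺ : the 8-cycle v0 … v7 v0 plus chords v0v4 and v2v6
thetaPlusEdges : List (ℕ × ℕ)
thetaPlusEdges =
  (0 , 1) ∷ (1 , 2) ∷ (2 , 3) ∷ (3 , 4) ∷ (4 , 5) ∷ (5 , 6) ∷ (6 , 7) ∷ (7 , 0) ∷
  (0 , 4) ∷ (2 , 6) ∷ []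

private
  ∨-comm : ∀ a b → (a ∨ b) ≡ (b ∨ a)
  ∨-comm false false = refl
  ∨-comm false true = refl
  ∨-comm true false = refl
  ∨-comm true true = refl

  ∧-comm : ∀ a b → (a ∧ b) ≡ (b ∧ a)
  ∧-comm false false = refl
  ∧-comm false true = refl
  ∧-comm true false = refl
  ∧-comm true true = refl

  edgeAdj-sym : {n : ℕ} (es : List (ℕ × ℕ)) (i j : Fin n) → edgeAdj es i j ≡ edgeAdj es j i
  edgeAdj-sym [] i j = refl
  edgeAdj-sym ((a , b) ∷ es) i j
    rewrite edgeAdj-sym es i j
          | ∨-comm ((a ≡ᵇ toℕ i) ∧ (b ≡ᵇ toℕ j)) ((a ≡ᵇ toℕ j) ∧ (b ≡ᵇ toℕ i)) = refl

petersen : Graph 10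
petersen = record
  { adj = edgeAdj petersenEdges
  ; sym = edgeAdj-sym petersenEdges
  ; irrefl = irr }
  where
  irr : ∀ i → edgeAdj petersenEdges i i ≡ false
  irr Fin.zero = refl
  irr (Fin.suc Fin.zero) = refl
  irr (Fin.suc (Fin.suc Fin.zero)) = refl
  irr (Fin.suc (Fin.suc (Fin.suc Fin.zero))) = refl
  irr (Fin.suc (Fin.suc (Fin.suc (Fin.suc Fin.zero)))) = refl
  irr (Fin.suc (Fin.suc (Fin.suc (Fin.suc (Fin.suc Fin.zero))))) = refl
  irr (Fin.suc (Fin.suc (Fin.suc (Fin.suc (Fin.suc (Fin.suc Fin.zero)))))) = refl
  irr (Fin.suc (Fin.suc (Fin.suc (Fin.suc (Fin.suc (Fin.suc (Fin.suc Fin.zero))))))) = refl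
  irr (Fin.suc (Fin.suc (Fin.suc (Fin.suc (Fin.suc (Fin.suc (Fin.suc (Fin.suc Fin.zero)))))))) = refl
  irr (Fin.suc (Fin.suc (Fin.suc (Fin.suc (Fin.suc (Fin.suc (Fin.suc (Fin.suc (Fin.suc Fin.zero))))))))) = refl

thetaPlus : Graph 8
thetaPlus = record
  { adj = edgeAdj thetaPlusEdges
  ; sym = edgeAdj-sym thetaPlusEdges
  ; irrefl = irr }
  where
  irr : ∀ i → edgeAdj thetaPlusEdges i i ≡ false
  irr Fin.zero = refl
  irr (Fin.suc Fin.zero) = refl
  irr (Fin.suc (Fin.suc Fin.zero)) = refl
  irr (Fin.suc (Fin.suc (Fin.suc Fin.zero))) = refl
  irr (Fin.suc (Fin.suc (Fin.suc (Fin.suc Fin.zero)))) = refl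
  irr (Fin.suc (Fin.suc (Fin.suc (Fin.suc (Fin.suc Fin.zero))))) = refl
  irr (Fin.suc (Fin.suc (Fin.suc (Fin.suc (Fin.suc (Fin.suc Fin.zero)))))) = refl
  irr (Fin.suc (Fin.suc (Fin.suc (Fin.suc (Fin.suc (Fin.suc (Fin.suc Fin.zero))))))) = refl

_≅_ : {n m : ℕ} → Graph n → Graph m → Set
_≅_ {n} {m} G H = Σ (Fin n → Fin m) λ f →
  Bijective _≡_ _≡_ f × (∀ i j → adj H (f i) (f j) ≡ adj G i j)

HasInduced : {n m : ℕ} → Graph n → Graph m → Set
HasInduced {n} {m} G H = Σ (Fin m → Fin n) λ f →
  Injective _≡_ _≡_ f × (∀ i j → adj G (f i) (f j) ≡ adj H i j)

-- adjacency of the cycle C_k on Fin k (i ~ i+1 mod k); a simple cycle for k ≥ 3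
cycAdj : (k : ℕ) → Fin k → Fin k → Bool
cycAdj zero () _
cycAdj (suc k) i j =
  ((suc (toℕ i) % suc k) ≡ᵇ toℕ j) ∨ ((suc (toℕ j) % suc k) ≡ᵇ toℕ i)

HasCycle : {n : ℕ} → Graph n → ℕ → Set
HasCycle {n} G k = Σ (Fin k → Fin n) λ f →
  Injective _≡_ _≡_ f × (∀ i j → cycAdj k i j ≡ true → adj G (f i) (f j) ≡ true)

-- G contains a hole of length k (an induced cycle of length k; meaningful for k ≥ 4)
HasHole : {n : ℕ} → Graph n → ℕ → Set
HasHole {n} G k = Σ (Fin k → Fin n) λ f →
  Injective _≡_ _≡_ f × (∀ i j → adj G (f i) (f j) ≡ cycAdj k i j)

GirthFive : {n : ℕ} → Graph n → Set
GirthFive G = (∀ k → 3 ≤ k → k < 5 → ¬ HasCycle G k) × HasCycle G 5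

Odd : ℕ → Set
Odd k = k % 2 ≡ 1

InG2 : {n : ℕ} → Graph n → Set
InG2 G = GirthFive G × (∀ k → 7 ≤ k → Odd k → ¬ HasHole G k)

-- walks in G − X (X a vertex subset; all vertices after the start avoid X)
data WalkAvoiding {n : ℕ} (G : Graph n) (X : Subset n) : Fin n → Fin n → Set where
  here : ∀ {u} → WalkAvoiding G X u u
  step : ∀ {u w v} → adj G u w ≡ true → w ∉ X → WalkAvoiding G X w v → WalkAvoiding G X u v

ConnectedAvoiding : {n : ℕ} → Graph n → Subset n → Set
ConnectedAvoiding {n} G X = ∀ u v → u ∉ X → v ∉ X → WalkAvoiding G X u v

ThreeConnected : {n : ℕ} → Graph n → Set
ThreeConnected {n} G = (4 ≤ n) × (∀ (X : Subset n) → ∣ X ∣ < 3 → ConnectedAvoiding G X)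

IsThreeCutset : {n : ℕ} → Graph n → Subset n → Set
IsThreeCutset G X = (∣ X ∣ ≡ 3) × ¬ ConnectedAvoiding G X

Stable : {n : ℕ} → Graph n → Subset n → Set
Stable G X = ∀ u v → u ∈ X → v ∈ X → adj G u v ≡ false

{-# OPTIONS --safe #-}

-- Label every vertex outside an induced θ⁺ by its neighbours in θ⁺; as G has girth five, the labels
-- of a vertex are pairwise at distance at least three. An induced path between vertices with
-- non-adjacent labels a, b closes up with any path from a to b in θ⁺ avoiding the labels met on
-- the way, so detours of lengths 3 and 4 together give an odd hole of length at least seven.
--
-- If some vertex has two labels then G contains the Petersen graph minus a vertex. Relative to that
-- graph, the same argument shows that single-label vertices joined by a walk see at most one edge xy.
-- At most one outside vertex z has several labels, since two of them lie on a cycle of length 4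
-- or a hole of length 7. So {x, y, z} would be an unstable cutset; hence there are no single-label
-- vertices, and z completes the Petersen graph.
--
-- Otherwise every outside vertex has at most one label. The labels seen by a component do not lie
-- in an unstable triple, and then they are v₀v₁v₃v₄, v₂v₃v₅v₆, v₀v₄v₅v₇ or v₁v₂v₆v₇. As each of
-- v₁, v₃, v₅, v₇ is seen, some two components see opposite sets, say the first and the third.
-- Then even paths v₃ ⋯ v₀ and v₀ ⋯ v₅ through these components and v₅ v₆ v₂ v₃ form an odd hole.
module Submission where

open import Defs
open import Data.Bool using (Bool; true; false; _∨_)
import Data.Bool.Properties as Bool
open import Data.Empty using (⊥; ⊥-elim)
open import Data.Fin as Fin using (Fin; zero; suc; toℕ; #_)
import Data.Fin.Properties as Fin
open import Data.Fin.Subset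
  using (Subset; _∈_; _∉_; _⊆_; _⊂_; _∪_; _-_; ⁅_⁆; ∣_∣; inside; outside) renaming (⊥ to ∅)
open import Data.Fin.Subset.Properties
open import Data.List as List using (List; []; _∷_; _++_; length)
open import Data.List.Properties using (length-++)
open import Data.List.Membership.Propositional using () renaming (_∈_ to _∈ˡ_)
open import Data.List.Membership.Propositional.Properties
  using (∈-++⁺ˡ; ∈-++⁺ʳ; ∈-++⁻; ∈-lookup)
open import Data.List.Relation.Binary.Subset.Propositional using () renaming (_⊆_ to _⊆ˡ_)
open import Data.List.Relation.Unary.All as All using (All; []; _∷_)
import Data.List.Relation.Unary.All.Properties as All
open import Data.List.Relation.Unary.Any as Any using (Any; here; there)
open import Data.Nat as ℕ using (ℕ; zero; suc; _+_; _%_; _≡ᵇ_; _≤_; _<_; z≤n; s≤s; s<s)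
open import Data.Nat.DivMod using (m<n⇒m%n≡m; n%n≡0)
import Data.Nat.Properties as ℕ
open import Data.Product using (Σ; ∃; _×_; _,_; proj₁; proj₂)
open import Data.Sum as Sum using (_⊎_; inj₁; inj₂; [_,_]′)
open import Data.Vec as Vec using (Vec; []; _∷_)
import Data.Vec.Properties as Vec
open import Function using (_∘_; id)
open import Function.Definitions using (Injective)
open import Relation.Binary.PropositionalEquality as ≡
  using (_≡_; _≢_; refl; cong; cong₂; subst)
open import Relation.Nullary using (¬_; Dec; yes; no)
open import Relation.Nullary.Decidable
  using (toWitness; _⊎-dec_; _×-dec_; _→-dec_; ¬?; map′)

private
  variable
    n m : ℕ

-- Adjacency, walks and induced paths.

Edge Link Apart : Graph n → Fin n → Fin n → Set
Edge G u v = adj G u v ≡ true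
Link G u v = u ≡ v ⊎ Edge G u v
Apart G u v = u ≢ v × adj G u v ≡ false

link? : (G : Graph n) (u v : Fin n) → Dec (Link G u v)
link? G u v = (u Fin.≟ v) ⊎-dec (adj G u v Bool.≟ true)

apart? : (G : Graph n) (u v : Fin n) → Dec (Apart G u v)
apart? G u v = ¬? (u Fin.≟ v) ×-dec (adj G u v Bool.≟ false)

edge-sym : (G : Graph n) {u v : Fin n} → Edge G u v → Edge G v u
edge-sym G {u} {v} e = ≡.trans (sym G v u) e

edge⇒≢ : (G : Graph n) {u v : Fin n} → Edge G u v → u ≢ v
edge⇒≢ G {u} e refl with ≡.trans (≡.sym e) (irrefl G u)
... | ()

apart⇒¬edge : (G : Graph n) {u v : Fin n} → Apart G u v → ¬ Edge G u v
apart⇒¬edge G (_ , a) e with ≡.trans (≡.sym e) a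
... | ()

apart-sym : (G : Graph n) {u v : Fin n} → Apart G u v → Apart G v u
apart-sym G {u} {v} (u≢v , a) = u≢v ∘ ≡.sym , ≡.trans (sym G v u) a

¬edge⇒false : (G : Graph n) {u v : Fin n} → ¬ Edge G u v → adj G u v ≡ false
¬edge⇒false G {u} {v} ¬e with adj G u v
... | true  = ⊥-elim (¬e refl)
... | false = refl

¬link⇒apart : (G : Graph n) {u v : Fin n} → ¬ Link G u v → Apart G u v
¬link⇒apart G ¬l = ¬l ∘ inj₁ , ¬edge⇒false G (¬l ∘ inj₂)

link-sym : (G : Graph n) {u v : Fin n} → Link G u v → Link G v u
link-sym G (inj₁ p) = inj₁ (≡.sym p)
link-sym G (inj₂ e) = inj₂ (edge-sym G e)

-- Steps of a walk may stay put, so that walks can be concatenated at a common vertex.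
data Walk (G : Graph n) : Fin n → List (Fin n) → Fin n → Set where
  [_] : ∀ u → Walk G u (u ∷ []) u
  _∷_ : ∀ {u w v xs} → Link G u w → Walk G w xs v → Walk G u (u ∷ xs) v

-- An induced path: every vertex is apart from all vertices beyond its successor. The list includes
-- both ends.
data Path (G : Graph n) : Fin n → List (Fin n) → Fin n → Set where
  [_]  : ∀ u → Path G u (u ∷ []) u
  cons : ∀ {u w v xs} → Edge G u w → Path G w (w ∷ xs) v → All (Apart G u) xs →
         Path G u (u ∷ w ∷ xs) v

module _ {G : Graph n} where

  walk-head : ∀ {u xs v} → Walk G u xs v → u ∈ˡ xs
  walk-head [ _ ]   = here refl
  walk-head (_ ∷ _) = here refl

  walk-last : ∀ {u xs v} → Walk G u xs v → v ∈ˡ xs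
  walk-last [ _ ]   = here refl
  walk-last (_ ∷ W) = there (walk-last W)

  append : ∀ {u xs v u′ ys v′} → Walk G u xs v → Link G v u′ → Walk G u′ ys v′ →
           Walk G u (xs ++ ys) v′
  append [ _ ]    l W′ = l ∷ W′
  append (l′ ∷ W) l W′ = l′ ∷ append W l W′

  reversed : ∀ {u xs v} → Walk G u xs v → ∃ λ ys → Walk G v ys u × ys ⊆ˡ xs
  reversed [ u ] = u ∷ [] , [ u ] , id
  reversed {u} {xs = _ ∷ xs} (l ∷ W) with ys , W′ , ys⊆ ← reversed W =
    ys ++ u ∷ [] , append W′ (link-sym G l) [ u ] ,
    λ p → [ there ∘ ys⊆ , (λ { (here refl) → here refl }) ]′ (∈-++⁻ ys p)

  upto : ∀ {u xs v p} → Walk G u xs v → p ∈ˡ xs → ∃ λ ys → Walk G u ys p × ys ⊆ˡ xs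
  upto [ u ]   (here refl) = u ∷ [] , [ u ] , id
  upto {u} (l ∷ W) (here refl) = u ∷ [] , [ u ] , λ { (here refl) → here refl }
  upto {u} (l ∷ W) (there p) with ys , W′ , ys⊆ ← upto W p =
    u ∷ ys , l ∷ W′ , λ { (here refl) → here refl ; (there q) → there (ys⊆ q) }

  between : ∀ {u xs v p q} → Walk G u xs v → p ∈ˡ xs → q ∈ˡ xs →
            ∃ λ ys → Walk G p ys q × ys ⊆ˡ xs
  between W p q
    with _ , A , A⊆ ← upto W p
    with as , A′ , A′⊆ ← reversed A
    with bs , B , B⊆ ← upto W q =
    as ++ bs , append A′ (inj₁ refl) B , [ A⊆ ∘ A′⊆ , B⊆ ]′ ∘ ∈-++⁻ as

  -- The walk runs along the first walk, back to `p`, over the link to `q`, back to the start of the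
  -- second walk and along it. So it visits exactly the vertices of both.
  merge : ∀ {u xs v u′ ys v′ p q} → Walk G u xs v → Walk G u′ ys v′ →
          p ∈ˡ xs → q ∈ˡ ys → Link G p q →
          ∃ λ zs → Walk G u zs v′ × xs ⊆ˡ zs × ys ⊆ˡ zs × zs ⊆ˡ xs ++ ys
  merge {xs = xs} {ys = ys} W W′ p q l
    with as , A , A⊆ ← between W (walk-last W) p
    with bs , B , B⊆ ← between W′ q (walk-head W′) =
    xs ++ as ++ bs ++ ys ,
    append W (inj₁ refl) (append A l (append B (inj₁ refl) W′)) ,
    ∈-++⁺ˡ ,
    ∈-++⁺ʳ xs ∘ ∈-++⁺ʳ as ∘ ∈-++⁺ʳ bs ,
    [ ∈-++⁺ˡ , [ ∈-++⁺ˡ ∘ A⊆ , [ ∈-++⁺ʳ xs ∘ B⊆ , ∈-++⁺ʳ xs ]′ ∘ ∈-++⁻ bs ]′ ∘ ∈-++⁻ as ]′ ∘ ∈-++⁻ xs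

  init : ∀ {u w v xs} → Link G u w → Walk G w xs v →
         ∃ λ z → ∃ λ ys → Walk G u ys z × u ∷ xs ≡ ys ++ v ∷ []
  init {u} l [ v ] = u , u ∷ [] , [ u ] , refl
  init {u} l (l′ ∷ W) with z , ys , W′ , eq ← init l′ W =
    z , u ∷ ys , l ∷ W′ , cong (u ∷_) eq

  -- The new path enters the old one at the last vertex linked to `u`, which makes it induced. If
  -- that vertex is `u` itself, the rest of the old path serves.
  attach : ∀ {u w v xs} → Path G w xs v → Any.Any (Link G u) xs →
           ∃ λ ys → Path G u ys v × ys ⊆ˡ u ∷ xs
  attach [ w ] (here (inj₁ refl)) = w ∷ [] , [ w ] , there
  attach {u} [ w ] (here (inj₂ e)) = u ∷ w ∷ [] , cons e [ w ] [] , id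
  attach {u} {xs = w ∷ w′ ∷ xs} P@(cons e Q as) t with Any.any? (link? G u) (w′ ∷ xs)
  ... | yes t′ with ys , R , ys⊆ ← attach Q t′ =
        ys , R , (λ { (here p) → here p ; (there p) → there (there p) }) ∘ ys⊆
  ... | no ¬t′ with t
  ...   | there t′ = ⊥-elim (¬t′ t′)
  ...   | here (inj₁ refl) = _ , P , there
  ...   | here (inj₂ e′) =
          _ , cons e′ P (All.map (¬link⇒apart G) (All.¬Any⇒All¬ _ ¬t′)) , id

  path-head : ∀ {u xs v} → Path G u xs v → u ∈ˡ xs
  path-head [ _ ]        = here refl
  path-head (cons _ _ _) = here refl

  shorten : ∀ {u xs v} → Walk G u xs v → ∃ λ ys → Path G u ys v × ys ⊆ˡ xs
  shorten [ u ] = _ , [ u ] , id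
  shorten (_∷_ {w = w} l W) with ys , P , ys⊆ ← shorten W
    with zs , Q , zs⊆ ← attach P (Any.map (λ { refl → l }) (path-head P)) =
      zs , Q , (λ { (here p) → here p ; (there p) → there (ys⊆ p) }) ∘ zs⊆

  apart-path : ∀ {u w v x xs} → Edge G u w → Path G w (w ∷ xs) v → All (Apart G u) xs →
               x ∈ˡ w ∷ xs → u ≢ x
  apart-path e P as (here refl) = edge⇒≢ G e
  apart-path e P as (there p)   = proj₁ (All.lookup as p)

  path-last : ∀ {u xs v} → Path G u xs v → v ∈ˡ xs
  path-last [ _ ]        = here refl
  path-last (cons _ P _) = there (path-last P)

  -- `ys` omits the shared vertex `v`. Only `v` may have neighbours in `ys`, and those are governed
  -- by the second path.
  join : ∀ {u xs v ys w} → Path G u xs v → Path G v (v ∷ ys) w →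
         All (λ p → All (λ q → p ≡ v ⊎ Apart G p q) ys) xs →
         Path G u (xs ++ ys) w
  join [ _ ] Q _ = Q
  join {u} {v = v} (cons e P as) Q (c ∷ cs) =
    cons e (join P Q cs) (All.++⁺ as (All.map (λ { (inj₁ u≡v) → ⊥-elim (u≢v u≡v)
                                                ; (inj₂ a) → a }) c))
    where
    u≢v : u ≢ v
    u≢v = apart-path e P as (path-last P)

  lookup-injective : ∀ {u xs v} → Path G u xs v → Injective _≡_ _≡_ (List.lookup xs)
  lookup-injective [ u ] {zero} {zero} _ = refl
  lookup-injective (cons e P as) {zero} {zero} _ = refl
  lookup-injective (cons e P as) {zero} {suc j} eq = ⊥-elim (apart-path e P as (∈-lookup j) eq)
  lookup-injective (cons e P as) {suc i} {zero} eq =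
    ⊥-elim (apart-path e P as (∈-lookup i) (≡.sym eq))
  lookup-injective (cons e P as) {suc i} {suc j} eq = cong suc (lookup-injective P eq)

  lookup-adj : ∀ {u xs v} → Path G u xs v → ∀ i j →
    adj G (List.lookup xs i) (List.lookup xs j) ≡
    (suc (toℕ i) ≡ᵇ toℕ j) ∨ (suc (toℕ j) ≡ᵇ toℕ i)
  lookup-adj [ u ] zero zero = irrefl G u
  lookup-adj {u} (cons e P as) zero zero = irrefl G u
  lookup-adj (cons e P as) zero (suc zero) = e
  lookup-adj (cons e P as) (suc zero) zero = edge-sym G e
  lookup-adj (cons e P as) zero (suc (suc j)) = proj₂ (All.lookup as (∈-lookup j))
  lookup-adj (cons e P as) (suc (suc i)) zero =
    proj₂ (apart-sym G (All.lookup as (∈-lookup i)))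
  lookup-adj (cons e P as) (suc i) (suc j) = lookup-adj P i j

  lookup-first : ∀ {u xs v} → Path G u xs v → ∀ i → List.lookup xs i ≡ u → toℕ i ≡ 0
  lookup-first [ _ ] zero _ = refl
  lookup-first P@(cons _ _ _) i eq = cong toℕ (lookup-injective P {i} {zero} eq)

  lookup-last : ∀ {u xs v} → Path G u xs v → ∀ i → List.lookup xs i ≡ v → suc (toℕ i) ≡ length xs
  lookup-last [ _ ] zero _ = refl
  lookup-last (cons e P as) zero eq = ⊥-elim (apart-path e P as (path-last P) eq)
  lookup-last (cons e P as) (suc i) eq = cong suc (lookup-last P i eq)

  at-first : ∀ {u xs v} → Path G u xs v → ∀ i → toℕ i ≡ 0 → List.lookup xs i ≡ u
  at-first [ _ ]        zero _ = refl
  at-first (cons _ _ _) zero _ = refl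

  wrap-first : ∀ {u xs v} → Path G u xs v → 1 % suc (length xs) ≡ 1
  wrap-first [ _ ]        = refl
  wrap-first (cons _ _ _) = refl

  at-last : ∀ {u xs v} → Path G u xs v → ∀ i → suc (toℕ i) ≡ length xs → List.lookup xs i ≡ v
  at-last [ _ ] zero _ = refl
  at-last (cons e P as) (suc i) eq = at-last P i (ℕ.suc-injective eq)

-- Closing induced paths to holes.

private
  ≡ᵇ-true : ∀ {a b} → a ≡ b → (a ≡ᵇ b) ≡ true
  ≡ᵇ-true {zero} refl = refl
  ≡ᵇ-true {suc a} refl = ≡ᵇ-true {a} refl

  ≡ᵇ-false : ∀ {a b} → a ≢ b → (a ≡ᵇ b) ≡ false
  ≡ᵇ-false {zero} {zero} ne = ⊥-elim (ne refl)
  ≡ᵇ-false {zero} {suc b} ne = refl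
  ≡ᵇ-false {suc a} {zero} ne = refl
  ≡ᵇ-false {suc a} {suc b} ne = ≡ᵇ-false {a} {b} (ne ∘ cong suc)

  -- Index `a` on a path of `l` vertices is position `suc a` on the hole of length `suc l`. Its
  -- cyclic successor is the apex, at position 0, only for the last vertex of the path.
  wrap : ∀ a l → suc a ≤ l → (suc a < l × suc (suc a) % suc l ≡ suc (suc a)) ⊎
                             (suc a ≡ l × suc (suc a) % suc l ≡ 0)
  wrap a l a≤ with ℕ.m≤n⇒m<n∨m≡n a≤
  ... | inj₁ a< = inj₁ (a< , m<n⇒m%n≡m (s<s a<))
  ... | inj₂ refl = inj₂ (refl , n%n≡0 (suc (suc a)))

module _ {G : Graph n} where

  -- The apex `c` gets position 0, ahead of the path. Lengths 3 and 4 are included, so triangles and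
  -- induced squares count as holes here.
  hole : ∀ {c u xs v} → Path G u xs v → Edge G c u → Edge G c v →
         All (λ p → p ≡ u ⊎ p ≡ v ⊎ Apart G c p) xs → HasHole G (suc (length xs))
  hole {c} {u} {xs} {v} P cu cv ends = f , inj , adjacent
    where
    k = length xs

    f : Fin (suc k) → Fin n
    f zero    = c
    f (suc i) = List.lookup xs i

    c≢ : ∀ i → c ≢ List.lookup xs i
    c≢ i eq with All.lookup ends (∈-lookup {xs = xs} i)
    ... | inj₁ p = edge⇒≢ G cu (≡.trans eq p)
    ... | inj₂ (inj₁ p) = edge⇒≢ G cv (≡.trans eq p)
    ... | inj₂ (inj₂ a) = proj₁ a eq

    inj : Injective _≡_ _≡_ f
    inj {zero}  {zero}  _  = refl
    inj {zero}  {suc j} eq = ⊥-elim (c≢ j eq)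
    inj {suc i} {zero}  eq = ⊥-elim (c≢ i (≡.sym eq))
    inj {suc i} {suc j} eq = cong suc (lookup-injective P eq)

    apex : ∀ i → adj G c (List.lookup xs i) ≡ cycAdj (suc k) zero (suc i)
    apex i rewrite wrap-first P with toℕ i ℕ.≟ 0
    ... | yes z rewrite at-first P i z | cu | ≡ᵇ-true (≡.sym z) = refl
    ... | no nz rewrite ≡ᵇ-false (nz ∘ ≡.sym) with wrap (toℕ i) k (Fin.toℕ<n i)
    ...   | inj₂ (l , eq) rewrite eq | at-last P i l = cv
    ...   | inj₁ (lt , eq) rewrite eq with All.lookup ends (∈-lookup {xs = xs} i)
    ...     | inj₁ p = ⊥-elim (nz (lookup-first P i p))
    ...     | inj₂ (inj₁ p) = ⊥-elim (ℕ.<⇒≢ lt (lookup-last P i p))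
    ...     | inj₂ (inj₂ a) = proj₂ a

    next : ∀ (i j : Fin k) → (suc (suc (toℕ i)) % suc k ≡ᵇ suc (toℕ j)) ≡ (suc (toℕ i) ≡ᵇ toℕ j)
    next i j with wrap (toℕ i) k (Fin.toℕ<n i)
    ... | inj₁ (_ , eq) rewrite eq = refl
    ... | inj₂ (l , eq) rewrite eq =
          ≡.sym (≡ᵇ-false {suc (toℕ i)} (λ e → ℕ.<⇒≢ (Fin.toℕ<n j) (≡.trans (≡.sym e) l)))

    adjacent : ∀ i j → adj G (f i) (f j) ≡ cycAdj (suc k) i j
    adjacent zero zero rewrite wrap-first P = irrefl G c
    adjacent zero (suc j) = apex j
    adjacent (suc i) zero = ≡.trans (sym G _ _) (≡.trans (apex i)
      (Bool.∨-comm (1 % suc k ≡ᵇ suc (toℕ i)) _))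
    adjacent (suc i) (suc j) = ≡.trans (lookup-adj P i j)
      (≡.sym (cong₂ _∨_ (next i j) (next j i)))

  -- `ps` ends in `y` and `qs` omits it, so with the apex `c` every vertex of the hole is counted
  -- once.
  closeUp : ∀ {c x y d ps qs} → Path G x ps y → Path G y (y ∷ qs) d →
            Edge G c x → Edge G c d →
            All (λ p → All (λ q → p ≡ y ⊎ Apart G p q) qs) ps →
            All (λ p → p ≡ x ⊎ Apart G c p) ps → All (λ q → q ≡ d ⊎ Apart G c q) qs →
            HasHole G (suc (length ps + length qs))
  closeUp {ps = ps} {qs} P Q cx cd cross cP cQ =
    subst (HasHole G ∘ suc) (length-++ ps)
      (hole (join P Q cross) cx cd
        (All.++⁺ (All.map [ inj₁ , inj₂ ∘ inj₂ ]′ cP) (All.map inj₂ cQ)))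

module _ (G : Graph n) (no₃ : ¬ HasHole G 3) where

  noTriangle : ∀ {a b c} → Edge G a b → Edge G b c → ¬ Edge G a c
  noTriangle {a} {b} {c} ab bc ac =
    no₃ (hole {G = G} (cons bc [ c ] []) ab ac (inj₁ refl ∷ inj₂ (inj₁ refl) ∷ []))

  noSquare : ¬ HasHole G 4 → ∀ {a b c d} → Edge G a b → Edge G b c → Edge G c d → Edge G a d →
             a ≢ c → ¬ (b ≢ d)
  noSquare no₄ {a} {b} {c} {d} ab bc cd ad a≢c b≢d =
    no₄ (hole {G = G} (cons bc (cons cd [ d ] []) ((b≢d , ¬edge⇒false G bd) ∷ [])) ab ad
      (inj₁ refl ∷ inj₂ (inj₂ (a≢c , ¬edge⇒false G (noTriangle ab bc))) ∷ inj₂ (inj₁ refl) ∷ []))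
    where
    bd : ¬ Edge G b d
    bd e = noTriangle ab e ad

-- Decidable conditions on sets of labels.

allSubset? : {P : Subset m → Set} → (∀ S → Dec (P S)) → Dec (∀ S → P S)
allSubset? {zero} P? = map′ (λ { p [] → p }) (λ p → p []) (P? [])
allSubset? {suc m} P? =
  map′ (λ { (p , q) (outside ∷ S) → p S ; (p , q) (inside ∷ S) → q S })
       (λ p → (λ S → p (outside ∷ S)) , λ S → p (inside ∷ S))
       (allSubset? (λ S → P? (outside ∷ S)) ×-dec allSubset? (λ S → P? (inside ∷ S)))

i∉p-i : ∀ (p : Subset m) i → i ∉ p - i
i∉p-i (_ ∷ p) zero    ()
i∉p-i (_ ∷ p) (suc i) (Vec.there q) = i∉p-i p i q

Thin : Subset m → Set
Thin S = ∀ i → i ∈ S → ∀ j → j ∈ S → i ≡ j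

thin? : (S : Subset m) → Dec (Thin S)
thin? S = Fin.all? λ i → (i ∈? S) →-dec Fin.all? λ j → (j ∈? S) →-dec (i Fin.≟ j)

-- As `S` is thin, `x` is its only element, so `x` is all that `S` adds to `T`.
thin-remove : ∀ {S T : Subset m} {x} → Thin S → x ∈ S → x ∉ T → T ≡ (S ∪ T) - x
thin-remove {S = S} {T} {x} thin x∈S x∉T = ⊆-antisym
  (λ {i} i∈T → x∈p∧x≢y⇒x∈p-y (q⊆p∪q S T i∈T) λ { refl → x∉T i∈T })
  (λ {i} i∈ → [ (λ i∈S → ⊥-elim (i∉p-i (S ∪ T) x
                  (subst (_∈ (S ∪ T) - x) (thin i i∈S x x∈S) i∈))) , id ]′
              (x∈p∪q⁻ S T (p─q⊆p (S ∪ T) ⁅ x ⁆ i∈)))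

absorb : ∀ {S T : Subset m} → ¬ (∃ λ i → i ∈ S × i ∉ T) → T ≡ S ∪ T
absorb {S = S} {T} none = ⊆-antisym (q⊆p∪q S T) ([ S⊆T , id ]′ ∘ x∈p∪q⁻ S T)
  where
  S⊆T : S ⊆ T
  S⊆T {i} i∈S with i ∈? T
  ... | yes i∈T = i∈T
  ... | no i∉T  = ⊥-elim (none (i , i∈S , i∉T))

module _ (B : Graph m) where

  -- Induced paths a c d b and a c d e b, of lengths 3 and 4, with interior outside `L`. The
  -- conditions on each vertex precede the choice of the next, so a search discards bad vertices
  -- early.
  Detour₃ Detour₄ : Subset m → Fin m → Fin m → Set
  Detour₃ L a b = ∃ λ c → Edge B a c × c ∉ L × Apart B c b ×
                  ∃ λ d → Edge B c d × d ∉ L × Edge B d b × Apart B a d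
  Detour₄ L a b = ∃ λ c → Edge B a c × c ∉ L × Apart B c b ×
                  ∃ λ d → Edge B c d × d ∉ L × Apart B a d × Apart B d b ×
                  ∃ λ e → Edge B d e × e ∉ L × Edge B e b × Apart B a e × Apart B c e

  -- The two detours differ in parity, so one of them closes an odd hole with any induced path from
  -- `a` to `b` through vertices with labels in `L`.
  Conflict : Subset m → Set
  Conflict L = ∃ λ a → a ∈ L × ∃ λ b → b ∈ L × Apart B a b × Detour₃ L a b × Detour₄ L a b

  edge? : ∀ a b → Dec (Edge B a b)
  edge? a b = adj B a b Bool.≟ true

  detour₃? : ∀ L a b → Dec (Detour₃ L a b)
  detour₃? L a b = Fin.any? λ c → edge? a c ×-dec ¬? (c ∈? L) ×-dec apart? B c b ×-dec
                   Fin.any? λ d → edge? c d ×-dec ¬? (d ∈? L) ×-dec edge? d b ×-dec apart? B a d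

  detour₄? : ∀ L a b → Dec (Detour₄ L a b)
  detour₄? L a b = Fin.any? λ c → edge? a c ×-dec ¬? (c ∈? L) ×-dec apart? B c b ×-dec
                   Fin.any? λ d → edge? c d ×-dec ¬? (d ∈? L) ×-dec apart? B a d ×-dec apart? B d b ×-dec
                   Fin.any? λ e → edge? d e ×-dec ¬? (e ∈? L) ×-dec edge? e b ×-dec apart? B a e ×-dec
                                  apart? B c e

  conflict? : ∀ L → Dec (Conflict L)
  conflict? L = Fin.any? λ a → (a ∈? L) ×-dec Fin.any? λ b → (b ∈? L) ×-dec apart? B a b ×-dec
                detour₃? L a b ×-dec detour₄? L a b

  -- Being a subset of a listed set is not enough: {v₀, v₃} lies in `quad₀` but has a conflict,
  -- since without the label v₁ the detour v₀v₁v₂v₃ is open.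
  Admissible : List (Subset m) → Subset m → Set
  Admissible 𝓜 L = Any (L ⊆_) 𝓜 × ¬ Conflict L

  admissible? : ∀ 𝓜 L → Dec (Admissible 𝓜 L)
  admissible? 𝓜 L = Any.any? (L ⊆?_) 𝓜 ×-dec ¬? (conflict? L)

  -- If a walk has label set L but its proper subwalks have fewer labels, then dropping its first
  -- and its last vertex loses distinct labels x and y.
  Growth : List (Subset m) → Set
  Growth 𝓜 = ∀ L x → x ∈ L → Admissible 𝓜 (L - x) → ∀ y → y ∈ L → Admissible 𝓜 (L - y) →
             x ≡ y ⊎ Admissible 𝓜 L ⊎ Conflict L

  growth? : ∀ 𝓜 → Dec (Growth 𝓜)
  growth? 𝓜 = allSubset? λ L → Fin.all? λ x → (x ∈? L) →-dec admissible? 𝓜 (L - x) →-dec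
              Fin.all? λ y → (y ∈? L) →-dec admissible? 𝓜 (L - y) →-dec
              ((x Fin.≟ y) ⊎-dec admissible? 𝓜 L ⊎-dec conflict? L)

adjoin : Graph m → Subset m → Graph (suc m)
adjoin B S = record
  { adj = λ { zero zero → false ; zero (suc j) → Vec.lookup S j
            ; (suc i) zero → Vec.lookup S i ; (suc i) (suc j) → adj B i j }
  ; sym = λ { zero zero → refl ; zero (suc j) → refl ; (suc i) zero → refl
            ; (suc i) (suc j) → sym B i j }
  ; irrefl = λ { zero → refl ; (suc i) → irrefl B i } }

-- The vertex t witnesses that the cutset leaves part of the graph.
Covered₂ Covered₃ : Graph m → Subset m → Set
Covered₂ B L = ∃ λ x → ∃ λ y → Edge B x y × (∀ j → j ∈ L → j ≡ x ⊎ j ≡ y) ×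
               ∃ λ t → t ≢ x × t ≢ y
Covered₃ B L = ∃ λ x → ∃ λ y → Edge B x y × ∃ λ w → (∀ j → j ∈ L → j ≡ x ⊎ j ≡ y ⊎ j ≡ w) ×
               ∃ λ t → t ≢ x × t ≢ y × t ≢ w

covered₂? : (B : Graph m) (L : Subset m) → Dec (Covered₂ B L)
covered₂? B L = Fin.any? λ x → Fin.any? λ y → edge? B x y ×-dec
  (Fin.all? λ j → (j ∈? L) →-dec ((j Fin.≟ x) ⊎-dec (j Fin.≟ y))) ×-dec
  Fin.any? λ t → ¬? (t Fin.≟ x) ×-dec ¬? (t Fin.≟ y)

covered₃? : (B : Graph m) (L : Subset m) → Dec (Covered₃ B L)
covered₃? B L = Fin.any? λ x → Fin.any? λ y → edge? B x y ×-dec Fin.any? λ w →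
  (Fin.all? λ j → (j ∈? L) →-dec ((j Fin.≟ x) ⊎-dec (j Fin.≟ y) ⊎-dec (j Fin.≟ w))) ×-dec
  Fin.any? λ t → ¬? (t Fin.≟ x) ×-dec ¬? (t Fin.≟ y) ×-dec ¬? (t Fin.≟ w)

-- Pairwise distance at least three, which the absence of triangles and squares forces on the
-- neighbours of an outside vertex.
Spread : Graph m → Subset m → Set
Spread B S = ∀ i → i ∈ S → ∀ j → j ∈ S → i ≡ j ⊎ Apart B i j × ∀ c → ¬ (Edge B i c × Edge B c j)

spread? : (B : Graph m) (S : Subset m) → Dec (Spread B S)
spread? B S = Fin.all? λ i → (i ∈? S) →-dec Fin.all? λ j → (j ∈? S) →-dec
  ((i Fin.≟ j) ⊎-dec apart? B i j ×-dec Fin.all? λ c → ¬? (edge? B i c ×-dec edge? B c j))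

-- `A` is a bare adjacency function, so that cycles (`cycAdj`) and graphs are treated alike.
Induces : {k : ℕ} → (Fin k → Fin k → Bool) → Graph m → (Fin k → Fin m) → Set
Induces A B g = (∀ i j → g i ≡ g j → i ≡ j) × (∀ i j → adj B (g i) (g j) ≡ A i j)

induces? : {k : ℕ} (A : Fin k → Fin k → Bool) (B : Graph m) (g : Fin k → Fin m) →
           Dec (Induces A B g)
induces? A B g = (Fin.all? λ i → Fin.all? λ j → (g i Fin.≟ g j) →-dec (i Fin.≟ j)) ×-dec
                 (Fin.all? λ i → Fin.all? λ j → adj B (g i) (g j) Bool.≟ A i j)

ShareTwo : Subset m → Subset m → Set
ShareTwo S T = ∃ λ i → ∃ λ j → i ≢ j × i ∈ S × i ∈ T × j ∈ S × j ∈ T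

shareTwo? : (S T : Subset m) → Dec (ShareTwo S T)
shareTwo? S T = Fin.any? λ i → Fin.any? λ j → ¬? (i Fin.≟ j) ×-dec (i ∈? S) ×-dec (i ∈? T) ×-dec
                (j ∈? S) ×-dec (j ∈? T)

-- An unstable triple contains all neighbours of a but not a itself, nor t: in the absence of unstable
-- 3-cutsets, an ambient graph must give a a further neighbour.
Sheltered : Graph m → Fin m → Set
Sheltered B a = ∃ λ x → ∃ λ y → Edge B x y × a ≢ x × a ≢ y × ∃ λ w → a ≢ w ×
  (∀ j → Edge B a j → j ≡ x ⊎ j ≡ y ⊎ j ≡ w) ×
  ∃ λ t → t ≢ x × t ≢ y × t ≢ w × a ≢ t

sheltered? : (B : Graph m) (a : Fin m) → Dec (Sheltered B a)
sheltered? B a = Fin.any? λ x → Fin.any? λ y →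
  edge? B x y ×-dec ¬? (a Fin.≟ x) ×-dec ¬? (a Fin.≟ y) ×-dec
  Fin.any? λ w → ¬? (a Fin.≟ w) ×-dec
  (Fin.all? λ j → edge? B a j →-dec ((j Fin.≟ x) ⊎-dec (j Fin.≟ y) ⊎-dec (j Fin.≟ w))) ×-dec
  Fin.any? λ t → ¬? (t Fin.≟ x) ×-dec ¬? (t Fin.≟ y) ×-dec ¬? (t Fin.≟ w) ×-dec ¬? (a Fin.≟ t)

-- The odd hole consists of a path a ⋯ b through vertices with labels in L, a path b ⋯ e through
-- vertices with labels in M, and e d c a.
Opposite : Graph m → (L M : Subset m) (a b e c d : Fin m) → Set
Opposite B L M a b e c d =
  (a ∈ L × b ∈ L × b ∈ M × e ∈ M) ×
  (a ∉ M × e ∉ L × c ∉ L × c ∉ M × d ∉ L × d ∉ M) ×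
  (Detour₄ B L a b × Detour₄ B M b e) ×
  (Edge B c a × Edge B c d × Edge B e d) ×
  (Apart B a b × Apart B b e × Apart B a e × Apart B a d × Apart B b d × Apart B c b × Apart B c e)

opposite? : (B : Graph m) (L M : Subset m) (a b e c d : Fin m) → Dec (Opposite B L M a b e c d)
opposite? B L M a b e c d =
  ((a ∈? L) ×-dec (b ∈? L) ×-dec (b ∈? M) ×-dec (e ∈? M)) ×-dec
  (¬? (a ∈? M) ×-dec ¬? (e ∈? L) ×-dec ¬? (c ∈? L) ×-dec ¬? (c ∈? M) ×-dec
   ¬? (d ∈? L) ×-dec ¬? (d ∈? M)) ×-dec
  (detour₄? B L a b ×-dec detour₄? B M b e) ×-dec
  (edge? B c a ×-dec edge? B c d ×-dec edge? B e d) ×-dec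
  (apart? B a b ×-dec apart? B b e ×-dec apart? B a e ×-dec apart? B a d ×-dec apart? B b d ×-dec
   apart? B c b ×-dec apart? B c e)

parity : ∀ k → k % 2 ≡ 0 ⊎ k % 2 ≡ 1
parity zero = inj₁ refl
parity (suc zero) = inj₂ refl
parity (suc (suc k)) = parity k

even⇒odd-suc : ∀ k → k % 2 ≡ 0 → Odd (suc k)
even⇒odd-suc zero    _ = refl
even⇒odd-suc (suc (suc k)) e = even⇒odd-suc k e

uncons : ∀ {G : Graph n} {u xs v} → Path G u xs v → ∃ λ ys → xs ≡ u ∷ ys × All (u ≢_) ys
uncons [ u ] = [] , refl , []
uncons {G = G} (cons e P as) = _ , refl , edge⇒≢ G e ∷ All.map proj₁ as

-- Counts vertices: a path with `a` of them, another with `suc b` that shares one end with it, and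
-- two further vertices.
odd-sum : ∀ a b → Odd a → Odd (suc b) → Odd (suc (a + b + 1))
odd-sum (suc zero) b _ o = subst (λ k → Odd k) (≡.sym (ℕ.+-comm b 1)) o
odd-sum (suc (suc a)) b oa ob = odd-sum a b oa ob

-- Labels with respect to an induced copy of `B`, and routes between them.

module Embedded (G : Graph n) (B : Graph m) (E : HasInduced G B)
  (noOddHole : ∀ k → 7 ≤ k → Odd k → ¬ HasHole G k) where

  f : Fin m → Fin n
  f = proj₁ E

  f-edge : ∀ {i j} → Edge B i j → Edge G (f i) (f j)
  f-edge e = ≡.trans (proj₂ (proj₂ E) _ _) e

  f-edge⁻ : ∀ {i j} → Edge G (f i) (f j) → Edge B i j
  f-edge⁻ e = ≡.trans (≡.sym (proj₂ (proj₂ E) _ _)) e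

  f-apart : ∀ {i j} → Apart B i j → Apart G (f i) (f j)
  f-apart (i≢j , e) = i≢j ∘ proj₁ (proj₂ E) , ≡.trans (proj₂ (proj₂ E) _ _) e

  labels : Fin n → Subset m
  labels v = Vec.tabulate λ i → adj G v (f i)

  ∈labels⁺ : ∀ {v i} → Edge G v (f i) → i ∈ labels v
  ∈labels⁺ {v} {i} e = Vec.lookup⇒[]= i _ (≡.trans (Vec.lookup∘tabulate _ i) e)

  ∈labels⁻ : ∀ {v i} → i ∈ labels v → Edge G v (f i)
  ∈labels⁻ {v} {i} p = ≡.trans (≡.sym (Vec.lookup∘tabulate _ i)) (Vec.[]=⇒lookup p)

  Outside Free : Fin n → Set
  Outside v = ∀ i → v ≢ f i
  Free v = Outside v × Thin (labels v)

  outside⊎image : ∀ v → Outside v ⊎ ∃ λ i → v ≡ f i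
  outside⊎image v with Fin.any? (λ i → v Fin.≟ f i)
  ... | yes p = inj₂ p
  ... | no ¬p = inj₁ λ i eq → ¬p (i , eq)

  labs : List (Fin n) → Subset m
  labs []       = ∅
  labs (v ∷ vs) = labels v ∪ labs vs

  ∈labs⁺ : ∀ {v xs i} → v ∈ˡ xs → i ∈ labels v → i ∈ labs xs
  ∈labs⁺ (here refl) i∈ = p⊆p∪q _ i∈
  ∈labs⁺ {xs = x ∷ xs} (there v∈) i∈ = q⊆p∪q (labels x) (labs xs) (∈labs⁺ v∈ i∈)

  ∈labs⁻ : ∀ xs {i} → i ∈ labs xs → ∃ λ v → v ∈ˡ xs × i ∈ labels v
  ∈labs⁻ [] i∈ = ⊥-elim (∉⊥ i∈)
  ∈labs⁻ (x ∷ xs) i∈ with x∈p∪q⁻ (labels x) (labs xs) i∈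
  ... | inj₁ p = x , here refl , p
  ... | inj₂ q with v , v∈ , i∈v ← ∈labs⁻ xs q = v , there v∈ , i∈v

  labs-mono : ∀ xs {ys} → xs ⊆ˡ ys → labs xs ⊆ labs ys
  labs-mono xs xs⊆ys i∈ with v , v∈ , i∈v ← ∈labs⁻ xs i∈ = ∈labs⁺ (xs⊆ys v∈) i∈v

  free-apart : ∀ {xs c p} → All Free xs → c ∉ labs xs → p ∈ˡ xs → Apart G p (f c)
  free-apart {c = c} free c∉ p∈ =
    proj₁ (All.lookup free p∈) c , ¬edge⇒false G (c∉ ∘ ∈labs⁺ p∈ ∘ ∈labels⁺)

  -- An induced path between two vertices of the copy, with interior in `xs`. As `ys` includes both
  -- ends, `long` says that it has at least three edges.
  record Route (xs : List (Fin n)) (a b : Fin m) : Set where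
    field
      {ys}    : List (Fin n)
      path    : Path G (f a) ys (f b)
      support : All (λ p → p ≡ f a ⊎ p ≡ f b ⊎ p ∈ˡ xs) ys
      long    : 4 ≤ length ys

  path-long : ∀ {x ys y} → Path G x ys y → Apart G x y →
              (∀ {z} → z ∈ˡ ys → Edge G x z → Edge G z y → ⊥) → 4 ≤ length ys
  path-long [ _ ] (x≢x , _) _ = ⊥-elim (x≢x refl)
  path-long (cons e [ _ ] _) ap _ = ⊥-elim (apart⇒¬edge G ap e)
  path-long (cons e (cons e′ [ _ ] _) _) _ far = ⊥-elim (far (there (here refl)) e e′)
  path-long (cons _ (cons _ (cons _ _ _) _) _) _ _ = s≤s (s≤s (s≤s (s≤s z≤n)))

  route : ∀ {u xs v a b} → Walk G u xs v → All Free xs → a ∈ labs xs → b ∈ labs xs →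
          Apart B a b → Route xs a b
  route {xs = xs} {a = a} {b} W free a∈ b∈ ab
    with p , p∈ , ap ← ∈labs⁻ xs a∈
    with q , q∈ , bq ← ∈labs⁻ xs b∈
    with zs , W′ , zs⊆ ← between W p∈ q∈
    with ys , P , ys⊆ ← shorten (inj₂ (edge-sym G (∈labels⁻ ap)) ∷
                                 append W′ (inj₂ (∈labels⁻ bq)) [ f b ]) =
    record { path = P ; support = All.tabulate (locate ∘ ys⊆) ; long = path-long P (f-apart ab)
      (λ z∈ → common (locate (ys⊆ z∈))) }
    where
    locate : ∀ {z} → z ∈ˡ f a ∷ zs ++ f b ∷ [] → z ≡ f a ⊎ z ≡ f b ⊎ z ∈ˡ xs
    locate (here eq) = inj₁ eq
    locate (there z∈) = [ inj₂ ∘ inj₂ ∘ zs⊆ , (λ { (here eq) → inj₂ (inj₁ eq) }) ]′ (∈-++⁻ zs z∈)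

    common : ∀ {z} → z ≡ f a ⊎ z ≡ f b ⊎ z ∈ˡ xs → Edge G (f a) z → Edge G z (f b) → ⊥
    common (inj₁ refl) e _ = edge⇒≢ G e refl
    common (inj₂ (inj₁ refl)) _ e = edge⇒≢ G e refl
    -- A common neighbour of both ends in `xs` would have the two labels `a` and `b`, but it is
    -- free.
    common (inj₂ (inj₂ z∈)) e e′ =
      proj₁ ab (proj₂ (All.lookup free z∈) _ (∈labels⁺ (edge-sym G e)) _ (∈labels⁺ e′))

  module _ {xs a b} (free : All Free xs) (ab : Apart B a b) (R : Route xs a b) where
    open Route R

    private
      cross : ∀ {q} → Apart B a q → q ∉ labs xs → ∀ {p} → p ≡ f a ⊎ p ≡ f b ⊎ p ∈ˡ xs →
              p ≡ f b ⊎ Apart G p (f q)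
      cross aq q∉ (inj₁ refl) = inj₂ (f-apart aq)
      cross aq q∉ (inj₂ (inj₁ eq)) = inj₁ eq
      cross aq q∉ (inj₂ (inj₂ p∈)) = inj₂ (free-apart free q∉ p∈)

      apex : ∀ {c} → Apart B c b → c ∉ labs xs → ∀ {p} → p ≡ f a ⊎ p ≡ f b ⊎ p ∈ˡ xs →
             p ≡ f a ⊎ Apart G (f c) p
      apex cb c∉ (inj₁ eq) = inj₁ eq
      apex cb c∉ (inj₂ (inj₁ refl)) = inj₂ (f-apart cb)
      apex cb c∉ (inj₂ (inj₂ p∈)) = inj₂ (apart-sym G (free-apart free c∉ p∈))

    hole₃ : Detour₃ B (labs xs) a b → HasHole G (suc (length ys + 1))
    hole₃ (c , ac , c∉ , cb , d , cd , d∉ , db , ad) =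
      closeUp path (cons (edge-sym G (f-edge db)) [ f d ] [])
        (edge-sym G (f-edge ac)) (f-edge cd)
        (All.map (λ s → cross ad d∉ s ∷ []) support)
        (All.map (apex cb c∉) support) (inj₁ refl ∷ [])

    hole₄ : Detour₄ B (labs xs) a b → HasHole G (suc (length ys + 2))
    hole₄ (c , ac , c∉ , cb , d , cd , d∉ , ad , db , e , de , e∉ , eb , ae , ce) =
      closeUp path (cons (edge-sym G (f-edge eb)) (cons (edge-sym G (f-edge de)) [ f d ] [])
                      (f-apart (apart-sym B db) ∷ []))
        (edge-sym G (f-edge ac)) (f-edge cd)
        (All.map (λ s → cross ae e∉ s ∷ cross ad d∉ s ∷ []) support)
        (All.map (apex cb c∉) support) (inj₂ (f-apart ce) ∷ inj₁ refl ∷ [])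

    -- An even number of vertices, with the three interior vertices of the detour, would give an odd
    -- hole of length at least 4 + 3.
    detour₄⇒odd : Detour₄ B (labs xs) a b → Odd (length ys)
    detour₄⇒odd D with parity (length ys)
    ... | inj₂ o = o
    ... | inj₁ e = ⊥-elim (noOddHole _ (s≤s (ℕ.+-monoˡ-≤ 2 long))
                     (subst Odd (cong suc (ℕ.+-comm 2 (length ys))) (even⇒odd-suc (length ys) e))
                     (hole₄ D))

    -- The long detour makes the number of vertices odd, hence at least five. With the two interior
    -- vertices of the short detour they form an odd hole of length at least 5 + 2.
    route-clash : Detour₃ B (labs xs) a b → Detour₄ B (labs xs) a b → ⊥
    route-clash D₃ D₄ = noOddHole _ (s≤s (ℕ.+-monoˡ-≤ 1 five))
      (subst Odd (cong suc (ℕ.+-comm 1 (length ys))) odd) (hole₃ D₃)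
      where
      odd : Odd (length ys)
      odd = detour₄⇒odd D₄

      five : 5 ≤ length ys
      five = ℕ.≤∧≢⇒< long λ eq → case4 (subst Odd (≡.sym eq) odd)
        where
        case4 : ¬ Odd 4
        case4 ()

  noConflict : ∀ {u xs v} → Walk G u xs v → All Free xs → ¬ Conflict B (labs xs)
  noConflict W free (a , a∈ , b , b∈ , ab , D₃ , D₄) =
    route-clash free ab (route W free a∈ b∈ ab) D₃ D₄

  labs-snoc : ∀ xs v → labs (xs ++ v ∷ []) ≡ labels v ∪ labs xs
  labs-snoc xs v = ⊆-antisym to from
    where
    to : labs (xs ++ v ∷ []) ⊆ labels v ∪ labs xs
    to i∈ with w , w∈ , i∈w ← ∈labs⁻ (xs ++ v ∷ []) i∈ with ∈-++⁻ xs w∈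
    ... | inj₁ w∈xs = q⊆p∪q (labels v) (labs xs) (∈labs⁺ w∈xs i∈w)
    ... | inj₂ (here refl) = p⊆p∪q _ i∈w

    from : labels v ∪ labs xs ⊆ labs (xs ++ v ∷ [])
    from i∈ with x∈p∪q⁻ (labels v) (labs xs) i∈
    ... | inj₁ p = ∈labs⁺ (∈-++⁺ʳ xs (here refl)) p
    ... | inj₂ q = labs-mono xs ∈-++⁺ˡ q

  module _ {𝓜 : List (Subset m)} (base : ∀ S → Thin S → Admissible B 𝓜 S) (growth : Growth B 𝓜) where

    private
      -- If dropping some end loses no label, the shorter walk sees the same set. Otherwise each end
      -- has a label of its own; the two differ because `u` survives when `v` is dropped, and
      -- `growth` applies.
      two-ends : ∀ {u xs v w ys z} → Walk G u (u ∷ xs) v → All Free (u ∷ xs) →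
             Admissible B 𝓜 (labs xs) → Walk G w ys z → u ∈ˡ ys → u ∷ xs ≡ ys ++ v ∷ [] →
             Admissible B 𝓜 (labs ys) → Admissible B 𝓜 (labs (u ∷ xs))
      two-ends {u} {xs} {v} {ys = ys} W free@((_ , thin) ∷ _) okxs V u∈ys eq okys
        with Fin.any? (λ i → (i ∈? labels u) ×-dec ¬? (i ∈? labs xs))
           | Fin.any? (λ i → (i ∈? labels v) ×-dec ¬? (i ∈? labs ys))
           | ≡.trans (cong labs eq) (labs-snoc ys v)
      ... | no none | _ | _ = subst (Admissible B 𝓜) (absorb none) okxs
      ... | yes _ | no none | L≡ = subst (Admissible B 𝓜) (≡.trans (absorb none) (≡.sym L≡)) okys
      ... | yes (x , x∈ , x∉) | yes (y , y∈ , y∉) | L≡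
        with growth (labs (u ∷ xs)) x (p⊆p∪q _ x∈)
               (subst (Admissible B 𝓜) (thin-remove thin x∈ x∉) okxs)
               y (subst (y ∈_) (≡.sym L≡) (p⊆p∪q _ y∈))
               (subst (Admissible B 𝓜) (≡.trans (thin-remove (proj₂ (All.lookup free (walk-last W))) y∈ y∉)
                                        (cong (_- y) (≡.sym L≡))) okys)
      ...   | inj₁ refl = ⊥-elim (y∉ (∈labs⁺ u∈ys x∈))
      ...   | inj₂ (inj₁ ok) = ok
      ...   | inj₂ (inj₂ con) = ⊥-elim (noConflict W free con)

      shorter : ∀ {u v : Fin n} {xs} ys → u ∷ xs ≡ ys ++ v ∷ [] → length xs ≡ length ys
      shorter ys eq = ℕ.suc-injective
        (≡.trans (cong length eq) (≡.trans (length-++ ys) (ℕ.+-comm (length ys) 1)))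

      go : ∀ k {u xs v} → length xs ≤ k → Walk G u xs v → All Free xs → Admissible B 𝓜 (labs xs)
      go _ _ [ u ] ((_ , thin) ∷ []) = subst (Admissible B 𝓜) (≡.sym (∪-identityʳ (labels u))) (base _ thin)
      go (suc k) {xs = u ∷ xs} {v} (s≤s len) W@(l ∷ W′) free@(_ ∷ free′)
        with z , ys , V , eq ← init l W′ =
        two-ends W free (go k len W′ free′) V (walk-head V) eq
          (go k (subst (_≤ k) (shorter ys eq) len) V (All.++⁻ˡ ys (subst (All Free) eq free)))

    walk-admissible : ∀ {u xs v} → Walk G u xs v → All Free xs → Admissible B 𝓜 (labs xs)
    walk-admissible = go _ ℕ.≤-refl

  -- The detours of length 4 force an odd number of vertices on both routes. Glued at `f b` and
  -- closed up by `f d` and the apex `f c`, they form an odd hole of length at least 4 + 3 + 2.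
  opposed : ∀ {u xs v u′ xs′ v′ a b c d e} → Walk G u xs v → Walk G u′ xs′ v′ →
    All Free xs → All Free xs′ → (∀ {p q} → p ∈ˡ xs → q ∈ˡ xs′ → Apart G p q) →
    ¬ Opposite B (labs xs) (labs xs′) a b e c d
  opposed {xs = xs} {xs′ = xs′} {a = a} {b} {c} {d} {e} W W′ free free′ separate
    ((a∈ , b∈ , b∈′ , e∈′) , (a∉′ , e∉ , c∉ , c∉′ , d∉ , d∉′) , (D , D′) ,
     (ca , cd , ed) , (ab , be , ae , ad , bd , cb , ce))
    with R  ← route W free a∈ b∈ ab | R′ ← route W′ free′ b∈′ e∈′ be
    with odd ← detour₄⇒odd free ab R D | odd′ ← detour₄⇒odd free′ be R′ D′
    with record { ys = ys ; path = P ; support = S ; long = long } ← R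
       | record { ys = zs ; path = Q ; support = S′ ; long = long′ } ← R′
    with qs , refl , b≢ ← uncons Q | _ ∷ S″ ← S′ =
    noOddHole _
      (s≤s (ℕ.≤-trans {6} {4 + 3 + 1} (ℕ.m≤m+n 6 2)
                      (ℕ.+-monoˡ-≤ 1 (ℕ.+-mono-≤ long (ℕ.≤-pred long′)))))
      (odd-sum (length ys) (length qs) odd odd′)
      (subst (λ k → HasHole G (suc (k + 1))) (length-++ ys)
        (closeUp (join P Q (All.map (λ s → All.map (cross s) (All.zip (b≢ , S″))) S))
          (cons (f-edge ed) [ f d ] []) (f-edge ca) (f-edge cd)
          (All.++⁺ (All.map (λ s → inj₂ (toD s) ∷ []) S) (All.map (λ s → toD′ s ∷ []) S″))
          (All.++⁺ (All.map toC S) (All.map (λ s → inj₂ (toC′ s)) S″))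
          (inj₁ refl ∷ [])))
    where
    cross : ∀ {p q} → p ≡ f a ⊎ p ≡ f b ⊎ p ∈ˡ xs → f b ≢ q × (q ≡ f b ⊎ q ≡ f e ⊎ q ∈ˡ xs′) →
            p ≡ f b ⊎ Apart G p q
    cross _ (b≢b , inj₁ refl) = ⊥-elim (b≢b refl)
    cross (inj₂ (inj₁ eq)) _ = inj₁ eq
    cross (inj₁ refl) (_ , inj₂ (inj₁ refl)) = inj₂ (f-apart ae)
    cross (inj₁ refl) (_ , inj₂ (inj₂ q∈)) = inj₂ (apart-sym G (free-apart free′ a∉′ q∈))
    cross (inj₂ (inj₂ p∈)) (_ , inj₂ (inj₁ refl)) = inj₂ (free-apart free e∉ p∈)
    cross (inj₂ (inj₂ p∈)) (_ , inj₂ (inj₂ q∈)) = inj₂ (separate p∈ q∈)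

    toD : ∀ {p} → p ≡ f a ⊎ p ≡ f b ⊎ p ∈ˡ xs → Apart G p (f d)
    toD (inj₁ refl) = f-apart ad
    toD (inj₂ (inj₁ refl)) = f-apart bd
    toD (inj₂ (inj₂ p∈)) = free-apart free d∉ p∈

    toD′ : ∀ {p} → p ≡ f b ⊎ p ≡ f e ⊎ p ∈ˡ xs′ → p ≡ f e ⊎ Apart G p (f d)
    toD′ (inj₁ refl) = inj₂ (f-apart bd)
    toD′ (inj₂ (inj₁ eq)) = inj₁ eq
    toD′ (inj₂ (inj₂ p∈)) = inj₂ (free-apart free′ d∉′ p∈)

    toC : ∀ {p} → p ≡ f a ⊎ p ≡ f b ⊎ p ∈ˡ xs → p ≡ f a ⊎ Apart G (f c) p
    toC (inj₁ eq) = inj₁ eq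
    toC (inj₂ (inj₁ refl)) = inj₂ (f-apart cb)
    toC (inj₂ (inj₂ p∈)) = inj₂ (apart-sym G (free-apart free c∉ p∈))

    toC′ : ∀ {p} → p ≡ f b ⊎ p ≡ f e ⊎ p ∈ˡ xs′ → Apart G (f c) p
    toC′ (inj₁ refl) = f-apart cb
    toC′ (inj₂ (inj₁ refl)) = f-apart ce
    toC′ (inj₂ (inj₂ p∈)) = apart-sym G (free-apart free′ c∉′ p∈)

  labels-spread : ¬ HasHole G 3 → ¬ HasHole G 4 → ∀ {v} → Outside v → Spread B (labels v)
  labels-spread no₃ no₄ {v} out i i∈ j j∈ with i Fin.≟ j
  ... | yes i≡j = inj₁ i≡j
  ... | no i≢j = inj₂
    ((i≢j , ¬edge⇒false B λ ij → noTriangle G no₃ (∈labels⁻ i∈) (f-edge ij) (∈labels⁻ j∈)) ,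
     λ c (ic , cj) → noSquare G no₃ no₄ (∈labels⁻ i∈) (f-edge ic) (f-edge cj) (∈labels⁻ j∈)
                       (out c) (i≢j ∘ proj₁ (proj₂ E)))

  adjoinVertex : ∀ {v S} → Outside v → labels v ≡ S → HasInduced G (adjoin B S)
  adjoinVertex {v} {S} out labels≡ = g , (λ {i} {j} → g-inj i j) , g-adj
    where
    g : Fin (suc m) → Fin n
    g zero    = v
    g (suc i) = f i

    label : ∀ i → adj G v (f i) ≡ Vec.lookup S i
    label i = ≡.trans (≡.sym (Vec.lookup∘tabulate _ i)) (cong (λ T → Vec.lookup T i) labels≡)

    g-inj : ∀ i j → g i ≡ g j → i ≡ j
    g-inj zero    zero    _  = refl
    g-inj zero    (suc j) eq = ⊥-elim (out j eq)
    g-inj (suc i) zero    eq = ⊥-elim (out i (≡.sym eq))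
    g-inj (suc i) (suc j) eq = cong suc (proj₁ (proj₂ E) eq)

    g-adj : ∀ i j → adj G (g i) (g j) ≡ adj (adjoin B S) i j
    g-adj zero    zero    = irrefl G v
    g-adj zero    (suc j) = label j
    g-adj (suc i) zero    = ≡.trans (sym G (f i) v) (label i)
    g-adj (suc i) (suc j) = proj₂ (proj₂ E) i j

-- Cutsets containing an edge.

⟨_,_,_⟩ : Fin n → Fin n → Fin n → Subset n
⟨ x , y , z ⟩ = ⁅ x ⁆ ∪ (⁅ y ⁆ ∪ ⁅ z ⁆)

module _ {x y z : Fin n} where

  ∈⟨⟩⁻ : ∀ {v} → v ∈ ⟨ x , y , z ⟩ → v ≡ x ⊎ v ≡ y ⊎ v ≡ z
  ∈⟨⟩⁻ v∈ = Sum.map (x∈⁅y⁆⇒x≡y x) (Sum.map (x∈⁅y⁆⇒x≡y y) (x∈⁅y⁆⇒x≡y z) ∘ x∈p∪q⁻ ⁅ y ⁆ ⁅ z ⁆)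
    (x∈p∪q⁻ ⁅ x ⁆ (⁅ y ⁆ ∪ ⁅ z ⁆) v∈)

  ∈⟨⟩⁺ : ∀ {v} → v ≡ x ⊎ v ≡ y ⊎ v ≡ z → v ∈ ⟨ x , y , z ⟩
  ∈⟨⟩⁺ (inj₁ refl) = x∈p∪q⁺ (inj₁ (x∈⁅x⁆ x))
  ∈⟨⟩⁺ (inj₂ (inj₁ refl)) = x∈p∪q⁺ (inj₂ (x∈p∪q⁺ (inj₁ (x∈⁅x⁆ y))))
  ∈⟨⟩⁺ (inj₂ (inj₂ refl)) = x∈p∪q⁺ (inj₂ (x∈p∪q⁺ (inj₂ (x∈⁅x⁆ z))))

∣⁅x⁆∪p∣≤1+∣p∣ : ∀ (x : Fin n) p → ∣ ⁅ x ⁆ ∪ p ∣ ≤ suc ∣ p ∣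
∣⁅x⁆∪p∣≤1+∣p∣ zero (outside ∷ p) rewrite ∪-identityˡ p = ℕ.≤-refl
∣⁅x⁆∪p∣≤1+∣p∣ zero (inside ∷ p) rewrite ∪-identityˡ p = ℕ.n≤1+n _
∣⁅x⁆∪p∣≤1+∣p∣ (suc x) (outside ∷ p) = ∣⁅x⁆∪p∣≤1+∣p∣ x p
∣⁅x⁆∪p∣≤1+∣p∣ (suc x) (inside ∷ p) = s≤s (∣⁅x⁆∪p∣≤1+∣p∣ x p)

∣⟨⟩∣≤3 : ∀ (x y z : Fin n) → ∣ ⟨ x , y , z ⟩ ∣ ≤ 3
∣⟨⟩∣≤3 x y z = ℕ.≤-trans (∣⁅x⁆∪p∣≤1+∣p∣ x _) (s≤s
  (ℕ.≤-trans (∣⁅x⁆∪p∣≤1+∣p∣ y _) (s≤s (ℕ.≤-reflexive (∣⁅x⁆∣≡1 z)))))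

-- `z` may coincide with `x` or `y`, which covers the removal of a mere edge. The double negation
-- stems from cutsets being defined by a negation.
EdgeCutsConnected : Graph n → Set
EdgeCutsConnected G = ∀ {x y} z → Edge G x y → ¬ ¬ ConnectedAvoiding G ⟨ x , y , z ⟩

-- With fewer than three distinct vertices this is 3-connectedness. Otherwise a disconnection would
-- yield a 3-cutset containing the edge xy.
edgeCutsConnected : {G : Graph n} → ThreeConnected G →
  (∀ X → IsThreeCutset G X → Stable G X) → EdgeCutsConnected G
edgeCutsConnected {G = G} (_ , connected) stable {x} {y} z xy ¬conn
  with ℕ.m≤n⇒m<n∨m≡n (∣⟨⟩∣≤3 x y z)
... | inj₁ lt = ¬conn (connected _ lt)
... | inj₂ eq with ≡.trans (≡.sym xy) (stable ⟨ x , y , z ⟩ (eq , ¬conn) x y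
                     (∈⟨⟩⁺ (inj₁ refl)) (∈⟨⟩⁺ {y = y} (inj₂ (inj₁ refl))))
...   | ()

module Cuts (G : Graph n) (B : Graph m) (E : HasInduced G B)
  (noOddHole : ∀ k → 7 ≤ k → Odd k → ¬ HasHole G k) (connected : EdgeCutsConnected G) where

  open Embedded G B E noOddHole

  record FreeWalk : Set where
    constructor freeWalk
    field
      {start end} : Fin n
      {vertices}  : List (Fin n)
      walk        : Walk G start vertices end
      free        : All Free vertices

    seen : Subset m
    seen = labs vertices

  open FreeWalk

  singleton : ∀ {v} → Free v → FreeWalk
  singleton {v} fv = freeWalk [ v ] (fv ∷ [])

  -- The given walk is followed until it first enters the copy of `B`. The vertices before that are
  -- outside and not in `X`, hence free, and are prepended to `W`; the vertex entered is the label
  -- `j`.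
  reach : ∀ {X t} → (∀ v → Outside v → Free v ⊎ v ∈ X) → (W : FreeWalk) →
          WalkAvoiding G X (start W) (f t) →
          ∃ λ W′ → seen W ⊆ seen W′ × ∃ λ j → j ∈ seen W′ × f j ∉ X
  reach _ W here = ⊥-elim (proj₁ (All.lookup (free W) (walk-head (walk W))) _ refl)
  reach free⊎∈ W (step {w = w} e w∉ avoiding) with outside⊎image w
  ... | inj₂ (j , refl) = W , id , j , ∈labs⁺ (walk-head (walk W)) (∈labels⁺ e) , w∉
  ... | inj₁ out with free⊎∈ w out
  ...   | inj₂ w∈ = ⊥-elim (w∉ w∈)
  ...   | inj₁ fw with W′ , sub , rest ←
              reach free⊎∈ (freeWalk (inj₂ (edge-sym G e) ∷ walk W) (fw ∷ free W)) avoiding =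
          W′ , sub ∘ labs-mono (vertices W) there , rest

  -- The vertex c is the only outside vertex with several labels, or a vertex of B if there is none.
  enlarge : ∀ {x y t} c → Edge B x y → (∀ v → Outside v → Free v ⊎ v ≡ c) → ¬ Free c →
            t ≢ x → t ≢ y → f t ≢ c → (W : FreeWalk) →
            (∀ j → j ∈ seen W → j ≡ x ⊎ j ≡ y ⊎ f j ≡ c) → ¬ ¬ ∃ λ W′ → seen W ⊂ seen W′
  enlarge {x} {y} {t} c xy others ¬fc t≢x t≢y t≢c W cover none =
    -- The walk from `start W` to `f t` enters the copy outside `X`; by `cover`, the label gained
    -- there is new.
    connected c (f-edge xy) λ conn →
      let W′ , sub , j , j∈ , j∉X = reach free⊎∈ W (conn (start W) (f t) start∉ t∉)
      in none (W′ , sub , j , j∈ , j∉X ∘ ∈⟨⟩⁺ ∘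
               Sum.map (cong f) (Sum.map (cong f) id) ∘ cover j)
    where
    X = ⟨ f x , f y , c ⟩

    free⊎∈ : ∀ v → Outside v → Free v ⊎ v ∈ X
    free⊎∈ v out = Sum.map id (λ v≡c → ∈⟨⟩⁺ (inj₂ (inj₂ v≡c))) (others v out)

    start-free = All.lookup (free W) (walk-head (walk W))

    start∉ : start W ∉ X
    start∉ s∈ with ∈⟨⟩⁻ s∈
    ... | inj₁ eq = proj₁ start-free x eq
    ... | inj₂ (inj₁ eq) = proj₁ start-free y eq
    ... | inj₂ (inj₂ eq) = ¬fc (subst Free eq start-free)

    t∉ : f t ∉ X
    t∉ t∈ with ∈⟨⟩⁻ t∈
    ... | inj₁ eq = t≢x (proj₁ (proj₂ E) eq)
    ... | inj₂ (inj₁ eq) = t≢y (proj₁ (proj₂ E) eq)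
    ... | inj₂ (inj₂ eq) = t≢c eq

  -- Each enlargement adds one of only `m` labels; `k` bounds the number of enlargements left.
  saturate : {C : Subset m → Set} → (∀ L → Dec (C L)) →
             (∀ W → C (seen W) → ¬ ¬ ∃ λ W′ → seen W ⊂ seen W′) →
             ∀ W → ¬ ¬ ∃ λ W′ → seen W ⊆ seen W′ × ¬ C (seen W′)
  saturate {C} C? grow W = go (suc m) W (ℕ.m≤m+n (suc m) _)
    where
    go : ∀ k W → m < k + ∣ seen W ∣ → ¬ ¬ ∃ λ W′ → seen W ⊆ seen W′ × ¬ C (seen W′)
    go zero W lt _ = ℕ.<⇒≱ lt (∣p∣≤n (seen W))
    go (suc k) W lt none with C? (seen W)
    ... | no ¬c = none (W , id , ¬c)
    ... | yes c = grow W c λ (W′ , W⊂W′) →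
      go k W′ (ℕ.<-≤-trans lt (ℕ.≤-trans (ℕ.≤-reflexive (≡.sym (ℕ.+-suc k _)))
                (ℕ.+-monoʳ-≤ k (p⊂q⇒∣p∣<∣q∣ W⊂W′))))
        λ (W″ , sub , ¬c) → none (W″ , sub ∘ proj₁ W⊂W′ , ¬c)

  -- A walk from `f a` to `f t` avoiding the triple must leave the copy at its first step.
  outside-neighbour : ∀ {a} → Sheltered B a → ¬ ¬ ∃ λ v → Outside v × a ∈ labels v
  outside-neighbour {a} (x , y , xy , a≢x , a≢y , w , a≢w , nbrs , t , t≢x , t≢y , t≢w , a≢t) none =
    connected (f w) (f-edge xy) λ conn →
      first (conn (f a) (f t) (∉X a≢x a≢y a≢w) (∉X t≢x t≢y t≢w)) refl refl
    where
    X = ⟨ f x , f y , f w ⟩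

    ∉X : ∀ {j} → j ≢ x → j ≢ y → j ≢ w → f j ∉ X
    ∉X j≢x j≢y j≢w j∈ with ∈⟨⟩⁻ j∈
    ... | inj₁ eq = j≢x (proj₁ (proj₂ E) eq)
    ... | inj₂ (inj₁ eq) = j≢y (proj₁ (proj₂ E) eq)
    ... | inj₂ (inj₂ eq) = j≢w (proj₁ (proj₂ E) eq)

    first : ∀ {u z} → WalkAvoiding G X u z → u ≡ f a → z ≡ f t → ⊥
    first here eq eq′ = a≢t (proj₁ (proj₂ E) (≡.trans (≡.sym eq) eq′))
    first (step {w = v} e v∉ _) refl _ with outside⊎image v
    ... | inj₁ out = none (v , out , ∈labels⁺ (edge-sym G e))
    ... | inj₂ (j , refl) =
          v∉ (∈⟨⟩⁺ (Sum.map (cong f) (Sum.map (cong f) (cong f)) (nbrs j (f-edge⁻ e))))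

-- Label sets in θ⁺ and in the Petersen graph minus a vertex.

lookup≡ : ∀ {a p} {A : Set a} {P : A → Set p} {xs x} → All P xs → Any (x ≡_) xs → P x
lookup≡ ps = All.lookupWith (λ { p refl → p }) ps

_≟ˢ_ : (S T : Subset m) → Dec (S ≡ T)
_≟ˢ_ = Vec.≡-dec Bool._≟_

⟦_⟧ : List (Fin m) → Subset m
⟦_⟧ = List.foldr (λ i S → ⁅ i ⁆ ∪ S) ∅

-- The 5-cycle v₀v₁v₂v₃v₄ minus v₂, and its images under repeated application of `rotate`.
quad₀ quad₁ quad₂ quad₃ : Subset 8
quad₀ = ⟦ # 0 ∷ # 1 ∷ # 3 ∷ # 4 ∷ [] ⟧
quad₁ = ⟦ # 2 ∷ # 3 ∷ # 5 ∷ # 6 ∷ [] ⟧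
quad₂ = ⟦ # 0 ∷ # 4 ∷ # 5 ∷ # 7 ∷ [] ⟧
quad₃ = ⟦ # 1 ∷ # 2 ∷ # 6 ∷ # 7 ∷ [] ⟧

quads : List (Subset 8)
quads = quad₀ ∷ quad₁ ∷ quad₂ ∷ quad₃ ∷ []

-- The inclusion-maximal label sets of walks.
thetaPlusParts : List (Subset 8)
thetaPlusParts = quads ++
  ⟦ # 1 ∷ # 2 ∷ # 3 ∷ [] ⟧ ∷ ⟦ # 3 ∷ # 4 ∷ # 5 ∷ [] ⟧ ∷ ⟦ # 5 ∷ # 6 ∷ # 7 ∷ [] ⟧ ∷
  ⟦ # 0 ∷ # 1 ∷ # 7 ∷ [] ⟧ ∷ ⟦ # 2 ∷ # 6 ∷ [] ⟧ ∷ []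

-- The pairs of vertices of θ⁺ at distance three.
antipodes : List (Subset 8)
antipodes = ⟦ # 1 ∷ # 5 ∷ [] ⟧ ∷ ⟦ # 3 ∷ # 7 ∷ [] ⟧ ∷ []

-- An automorphism of θ⁺ that swaps the two chords and also the two antipodal pairs.
rotate : Fin 8 → Fin 8
rotate = Vec.lookup (# 2 ∷ # 3 ∷ # 4 ∷ # 5 ∷ # 6 ∷ # 7 ∷ # 0 ∷ # 1 ∷ [])

QuadsAt : Fin 8 → Subset 8 → Subset 8 → Set
QuadsAt a P Q = All (λ S → a ∈ S → S ≡ P ⊎ S ≡ Q) quads

quadsAt? : ∀ a P Q → Dec (QuadsAt a P Q)
quadsAt? a P Q = All.all? (λ S → (a ∈? S) →-dec ((S ≟ˢ P) ⊎-dec (S ≟ˢ Q))) quads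

-- The Petersen graph minus a vertex: vertex 0 is adjacent to v₁ and v₅, and vertex suc i is vᵢ.
petersen⁻ : Graph 9
petersen⁻ = adjoin thetaPlus ⟦ # 1 ∷ # 5 ∷ [] ⟧

petersen⁻-edges : List (Subset 9)
petersen⁻-edges =
  ⟦ # 0 ∷ # 2 ∷ [] ⟧ ∷ ⟦ # 0 ∷ # 6 ∷ [] ⟧ ∷ ⟦ # 1 ∷ # 2 ∷ [] ⟧ ∷ ⟦ # 2 ∷ # 3 ∷ [] ⟧ ∷
  ⟦ # 3 ∷ # 4 ∷ [] ⟧ ∷ ⟦ # 4 ∷ # 5 ∷ [] ⟧ ∷ ⟦ # 5 ∷ # 6 ∷ [] ⟧ ∷ ⟦ # 6 ∷ # 7 ∷ [] ⟧ ∷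
  ⟦ # 7 ∷ # 8 ∷ [] ⟧ ∷ ⟦ # 8 ∷ # 1 ∷ [] ⟧ ∷ ⟦ # 1 ∷ # 5 ∷ [] ⟧ ∷ ⟦ # 3 ∷ # 7 ∷ [] ⟧ ∷ []

-- The sets of at least two vertices of degree 2 in petersen⁻.
fatLabels : List (Subset 9)
fatLabels = ⟦ # 4 ∷ # 8 ∷ [] ⟧ ∷ ⟦ # 0 ∷ # 4 ∷ [] ⟧ ∷ ⟦ # 0 ∷ # 8 ∷ [] ⟧ ∷
            ⟦ # 0 ∷ # 4 ∷ # 8 ∷ [] ⟧ ∷ []

-- Vertices 0 and 1 are two outside vertices, vertices 2, …, 10 those of petersen⁻.
sevenCycles : List (Vec (Fin 11) 7)
sevenCycles =
  (# 10 ∷ # 1 ∷ # 6 ∷ # 0 ∷ # 2 ∷ # 8 ∷ # 9 ∷ []) ∷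
  (# 10 ∷ # 0 ∷ # 6 ∷ # 1 ∷ # 2 ∷ # 8 ∷ # 9 ∷ []) ∷
  (# 6 ∷ # 1 ∷ # 10 ∷ # 0 ∷ # 2 ∷ # 4 ∷ # 5 ∷ []) ∷
  (# 6 ∷ # 0 ∷ # 10 ∷ # 1 ∷ # 2 ∷ # 4 ∷ # 5 ∷ []) ∷
  (# 6 ∷ # 1 ∷ # 2 ∷ # 0 ∷ # 10 ∷ # 3 ∷ # 7 ∷ []) ∷
  (# 6 ∷ # 0 ∷ # 2 ∷ # 1 ∷ # 10 ∷ # 3 ∷ # 7 ∷ []) ∷ []

-- Vertex 0 has the labels `T` and vertex 1 the labels `S`. The entry `outside` makes them
-- nonadjacent, as is forced once they share a label.
SevenHole : Subset 9 → Subset 9 → Set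
SevenHole S T = Any (λ c → Induces (cycAdj 7) (adjoin (adjoin petersen⁻ S) (outside ∷ T)) (Vec.lookup c))
                    sevenCycles

petersen⁻⁺ : Graph 10
petersen⁻⁺ = adjoin petersen⁻ ⟦ # 0 ∷ # 4 ∷ # 8 ∷ [] ⟧

toPetersen⁻⁺ : Fin 10 → Fin 10
toPetersen⁻⁺ = Vec.lookup
  (# 0 ∷ # 1 ∷ # 3 ∷ # 2 ∷ # 9 ∷ # 5 ∷ # 7 ∷ # 4 ∷ # 6 ∷ # 8 ∷ [])

-- Facts verified by exhaustive search.

abstract
  theta-growth : Growth thetaPlus thetaPlusParts
  theta-growth = toWitness {a? = growth? thetaPlus thetaPlusParts} _

  theta-base : ∀ S → Thin S → Admissible thetaPlus thetaPlusParts S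
  theta-base = toWitness {a? = allSubset? λ S → thin? S →-dec admissible? thetaPlus thetaPlusParts S} _

  -- A free walk that cannot be enlarged past an unstable triple must therefore see exactly a quad.
  theta-covered : ∀ L → Admissible thetaPlus thetaPlusParts L → Covered₃ thetaPlus L ⊎ Any (L ≡_) quads
  theta-covered = toWitness {a? = allSubset? λ L → admissible? thetaPlus thetaPlusParts L →-dec
    (covered₃? thetaPlus L ⊎-dec Any.any? (L ≟ˢ_) quads)} _

  theta-spread : ∀ S → Spread thetaPlus S → Thin S ⊎ Any (S ≡_) antipodes
  theta-spread = toWitness {a? = allSubset? λ S → spread? thetaPlus S →-dec
    (thin? S ⊎-dec Any.any? (S ≟ˢ_) antipodes)} _

  petersen⁻-growth : Growth petersen⁻ petersen⁻-edges
  petersen⁻-growth = toWitness {a? = growth? petersen⁻ petersen⁻-edges} _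

  petersen⁻-base : ∀ S → Thin S → Admissible petersen⁻ petersen⁻-edges S
  petersen⁻-base = toWitness {a? = allSubset? λ S → thin? S →-dec admissible? petersen⁻ petersen⁻-edges S} _

  petersen⁻-covered : ∀ L → Admissible petersen⁻ petersen⁻-edges L → Covered₂ petersen⁻ L
  petersen⁻-covered = toWitness {a? = allSubset? λ L → admissible? petersen⁻ petersen⁻-edges L →-dec
    covered₂? petersen⁻ L} _

  petersen⁻-spread : ∀ S → Spread petersen⁻ S → Thin S ⊎ Any (S ≡_) fatLabels
  petersen⁻-spread = toWitness {a? = allSubset? λ S → spread? petersen⁻ S →-dec
    (thin? S ⊎-dec Any.any? (S ≟ˢ_) fatLabels)} _

  -- Two sets of at least two among the three vertices of degree 2 always meet. Two common labels
  -- lead to a square, a single one to a hole of length seven.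
  two-fat-table : All (λ S → All (λ T → ShareTwo S T ⊎ (∃ λ i → i ∈ S × i ∈ T) × SevenHole S T)
                           fatLabels) fatLabels
  two-fat-table = toWitness {a? = All.all? (λ S → All.all? (λ T →
    shareTwo? S T ⊎-dec Fin.any? (λ i → (i ∈? S) ×-dec (i ∈? T)) ×-dec
    Any.any? (λ c → induces? (cycAdj 7) (adjoin (adjoin petersen⁻ S) (outside ∷ T)) (Vec.lookup c))
      sevenCycles) fatLabels) fatLabels} _

  toPetersen⁻⁺-induces : Induces (adj petersen) petersen⁻⁺ toPetersen⁻⁺
  toPetersen⁻⁺-induces = toWitness {a? = induces? (adj petersen) petersen⁻⁺ toPetersen⁻⁺} _

  toPetersen⁻⁺-surjective : ∀ j → ∃ λ i → j ≡ toPetersen⁻⁺ i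
  toPetersen⁻⁺-surjective = toWitness {a? = Fin.all? λ j → Fin.any? λ i → j Fin.≟ toPetersen⁻⁺ i} _

  rotate-induces : Induces (adj thetaPlus) thetaPlus rotate
  rotate-induces = toWitness {a? = induces? (adj thetaPlus) thetaPlus rotate} _

  fat-all : All (λ S → # 0 ∈ S → # 4 ∈ S → # 8 ∈ S → S ≡ ⟦ # 0 ∷ # 4 ∷ # 8 ∷ [] ⟧) fatLabels
  fat-all = toWitness {a? = All.all? (λ S → (# 0 ∈? S) →-dec (# 4 ∈? S) →-dec (# 8 ∈? S) →-dec
    (S ≟ˢ _)) fatLabels} _

  opposite₀₂ : Opposite thetaPlus quad₀ quad₂ (# 3) (# 0) (# 5) (# 2) (# 6)
  opposite₀₂ = toWitness {a? = opposite? thetaPlus quad₀ quad₂ (# 3) (# 0) (# 5) (# 2) (# 6)} _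

  opposite₁₃ : Opposite thetaPlus quad₁ quad₃ (# 5) (# 2) (# 7) (# 4) (# 0)
  opposite₁₃ = toWitness {a? = opposite? thetaPlus quad₁ quad₃ (# 5) (# 2) (# 7) (# 4) (# 0)} _

  petersen⁻-sheltered-0 : Sheltered petersen⁻ (# 0)
  petersen⁻-sheltered-0 = toWitness {a? = sheltered? petersen⁻ (# 0)} _

  petersen⁻-sheltered-4 : Sheltered petersen⁻ (# 4)
  petersen⁻-sheltered-4 = toWitness {a? = sheltered? petersen⁻ (# 4)} _

  petersen⁻-sheltered-8 : Sheltered petersen⁻ (# 8)
  petersen⁻-sheltered-8 = toWitness {a? = sheltered? petersen⁻ (# 8)} _

  theta-sheltered-1 : Sheltered thetaPlus (# 1)
  theta-sheltered-1 = toWitness {a? = sheltered? thetaPlus (# 1)} _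

  theta-sheltered-3 : Sheltered thetaPlus (# 3)
  theta-sheltered-3 = toWitness {a? = sheltered? thetaPlus (# 3)} _

  theta-sheltered-5 : Sheltered thetaPlus (# 5)
  theta-sheltered-5 = toWitness {a? = sheltered? thetaPlus (# 5)} _

  theta-sheltered-7 : Sheltered thetaPlus (# 7)
  theta-sheltered-7 = toWitness {a? = sheltered? thetaPlus (# 7)} _

  quads-at-1 : QuadsAt (# 1) quad₀ quad₃
  quads-at-1 = toWitness {a? = quadsAt? (# 1) quad₀ quad₃} _

  quads-at-3 : QuadsAt (# 3) quad₀ quad₁
  quads-at-3 = toWitness {a? = quadsAt? (# 3) quad₀ quad₁} _

  quads-at-5 : QuadsAt (# 5) quad₁ quad₂
  quads-at-5 = toWitness {a? = quadsAt? (# 5) quad₁ quad₂} _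

  quads-at-7 : QuadsAt (# 7) quad₂ quad₃
  quads-at-7 = toWitness {a? = quadsAt? (# 7) quad₂ quad₃} _

  no-union₀₂ : ¬ Any ((quad₀ ∪ quad₂) ⊆_) thetaPlusParts
  no-union₀₂ = toWitness {a? = ¬? (Any.any? ((quad₀ ∪ quad₂) ⊆?_) thetaPlusParts)} _

  no-union₁₃ : ¬ Any ((quad₁ ∪ quad₃) ⊆_) thetaPlusParts
  no-union₁₃ = toWitness {a? = ¬? (Any.any? ((quad₁ ∪ quad₃) ⊆?_) thetaPlusParts)} _

two-fat : ∀ {S T} → Any (S ≡_) fatLabels → Any (T ≡_) fatLabels →
          ShareTwo S T ⊎ (∃ λ i → i ∈ S × i ∈ T) × SevenHole S T
two-fat S∈ T∈ = lookup≡ (lookup≡ two-fat-table S∈) T∈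

-- Restricted and spanning embeddings.

restrict : (G : Graph n) (B : Graph m) {k : ℕ} (A : Fin k → Fin k → Bool) {g : Fin k → Fin m} →
           HasInduced G B → Induces A B g →
           Σ (Fin k → Fin n) λ h → Injective _≡_ _≡_ h × (∀ i j → adj G (h i) (h j) ≡ A i j)
restrict G B A {g} (f , f-inj , f-adj) (g-inj , g-adj) =
  f ∘ g , (λ eq → g-inj _ _ (f-inj eq)) , λ i j → ≡.trans (f-adj (g i) (g j)) (g-adj i j)

spanning⇒≅ : (G : Graph n) (B : Graph m) (E : HasInduced G B) → (∀ v → ∃ λ i → v ≡ proj₁ E i) → G ≅ B
spanning⇒≅ {n = n} {m} G B (f , f-inj , f-adj) onto =
  g , (g-inj , λ i → f i , λ { refl → f-inj (≡.sym (fg (f i))) }) ,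
  λ i j → ≡.trans (≡.sym (f-adj (g i) (g j))) (≡.sym (cong₂ (adj G) (fg i) (fg j)))
  where
  g : Fin n → Fin m
  g v = proj₁ (onto v)

  fg : ∀ v → v ≡ f (g v)
  fg v = proj₂ (onto v)

  g-inj : Injective _≡_ _≡_ g
  g-inj {u} {v} eq = ≡.trans (fg u) (≡.trans (cong f eq) (≡.sym (fg v)))

hole⇒cycle : (G : Graph n) {k : ℕ} → HasHole G k → HasCycle G k
hole⇒cycle _ (f , f-inj , f-adj) = f , f-inj , λ i j e → ≡.trans (f-adj i j) e

module _ {G : Graph n} (no₃ : ¬ HasHole G 3) (no₄ : ¬ HasHole G 4)
  (noOddHole : ∀ k → 7 ≤ k → Odd k → ¬ HasHole G k) (connected : EdgeCutsConnected G) where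

  -- Graphs containing the Petersen graph minus a vertex.

  module _ (E : HasInduced G petersen⁻) where

    open Embedded G petersen⁻ E noOddHole
    open Cuts G petersen⁻ E noOddHole connected

    Fat : Fin n → Set
    Fat v = Outside v × ¬ Thin (labels v)

    free⊎fat : ∀ v → Outside v → Free v ⊎ Fat v
    free⊎fat v out with thin? (labels v)
    ... | yes thin = inj₁ (out , thin)
    ... | no ¬thin = inj₂ (out , ¬thin)

    fat-labels : ∀ {v} → Fat v → Any (labels v ≡_) fatLabels
    fat-labels {v} (out , ¬thin) with petersen⁻-spread (labels v) (labels-spread no₃ no₄ out)
    ... | inj₁ thin = ⊥-elim (¬thin thin)
    ... | inj₂ fat  = fat

    fat-unique : ∀ {u v} → Fat u → Fat v → u ≡ v
    fat-unique {u} {v} fu@(out-u , _) fv@(out-v , _) with u Fin.≟ v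
    ... | yes u≡v = u≡v
    ... | no u≢v = ⊥-elim (clash (two-fat (fat-labels fu) (fat-labels fv)))
      where
      apart : ∀ {i} → i ∈ labels u → i ∈ labels v → Apart G u v
      apart i∈u i∈v = u≢v , ¬edge⇒false G λ uv → noTriangle G no₃ uv (∈labels⁻ i∈v) (∈labels⁻ i∈u)

      clash : ¬ (ShareTwo (labels u) (labels v) ⊎
                 (∃ λ i → i ∈ labels u × i ∈ labels v) × SevenHole (labels u) (labels v))
      clash (inj₁ (i , j , i≢j , iu , iv , ju , jv)) =
        noSquare G no₃ no₄ (∈labels⁻ iu) (edge-sym G (∈labels⁻ iv)) (∈labels⁻ jv) (∈labels⁻ ju)
          u≢v (i≢j ∘ proj₁ (proj₂ E))
      clash (inj₂ ((i , iu , iv) , cycles)) = noOddHole 7 ℕ.≤-refl refl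
        (let c , induces = Any.satisfied cycles
         in restrict G B₂ (cycAdj 7) {Vec.lookup c} E₂ induces)
        where
        module U = Embedded G (adjoin petersen⁻ (labels u)) (adjoinVertex out-u refl) noOddHole
        vu = apart-sym G (apart iu iv)
        B₂ : Graph 11
        B₂ = adjoin (adjoin petersen⁻ (labels u)) (outside ∷ labels v)
        E₂ : HasInduced G B₂
        -- Relative to the copy extended by `u`, the vertex `v` has the labels it had before, and
        -- not `u`.
        E₂ = U.adjoinVertex (λ { zero → proj₁ vu ; (suc j) → out-v j }) (cong (_∷ labels v) (proj₂ vu))

    -- By `petersen⁻-covered`, every free walk sees at most the ends of an edge, and `enlarge` then
    -- provides a walk seeing more. This cannot go on for ever.
    no-free : ∀ v → ¬ Free v
    no-free v fv = saturate (covered₂? petersen⁻) grow (singleton fv)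
      λ (W , _ , ¬c) → ¬c (petersen⁻-covered _
        (walk-admissible petersen⁻-base petersen⁻-growth (FreeWalk.walk W) (FreeWalk.free W)))
      where
      grow : ∀ W → Covered₂ petersen⁻ (FreeWalk.seen W) →
             ¬ ¬ ∃ λ W′ → FreeWalk.seen W ⊂ FreeWalk.seen W′
      grow W (x , y , xy , cover , t , t≢x , t≢y)
        with Fin.any? (λ v → Fin.all? (λ i → ¬? (v Fin.≟ f i)) ×-dec ¬? (thin? (labels v)))
      ... | yes (z , fz@(out-z , ¬thin)) =
            enlarge z xy (λ v → Sum.map id (λ fv → fat-unique fv fz) ∘ free⊎fat v)
              (¬thin ∘ proj₂) t≢x t≢y (λ eq → out-z t (≡.sym eq)) W (λ j → Sum.map id inj₁ ∘ cover j)
      ... | no none =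
            -- Without a fat vertex, the two ends of the edge suffice as cutset, so `f x` is
            -- repeated.
            enlarge (f x) xy (λ v → [ inj₁ , (λ fv → ⊥-elim (none (v , fv))) ]′ ∘ free⊎fat v)
              (λ (out , _) → out x refl) t≢x t≢y (t≢x ∘ proj₁ (proj₂ E)) W
              (λ j → Sum.map id inj₁ ∘ cover j)

    outside⇒fat : ∀ {v} → Outside v → Fat v
    outside⇒fat out = [ ⊥-elim ∘ no-free _ , id ]′ (free⊎fat _ out)

    completed : ∀ {v} → Outside v → labels v ≡ ⟦ # 0 ∷ # 4 ∷ # 8 ∷ [] ⟧ → G ≅ petersen
    completed {v} out labels≡ =
      spanning⇒≅ G petersen
        (restrict G petersen⁻⁺ (adj petersen) {toPetersen⁻⁺} E⁺ toPetersen⁻⁺-induces) onto′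
      where
      E⁺ : HasInduced G petersen⁻⁺
      E⁺ = adjoinVertex out labels≡

      onto : ∀ u → ∃ λ i → u ≡ proj₁ E⁺ i
      onto u with outside⊎image u
      ... | inj₁ out-u    = zero , fat-unique (outside⇒fat out-u) (outside⇒fat out)
      ... | inj₂ (i , eq) = suc i , eq

      onto′ : ∀ u → ∃ λ i → u ≡ proj₁ E⁺ (toPetersen⁻⁺ i)
      onto′ u with i , eq ← onto u with j , eq′ ← toPetersen⁻⁺-surjective i =
        j , ≡.trans eq (cong (proj₁ E⁺) eq′)

    -- Each of the three vertices of degree 2 has an outside neighbour. All outside vertices are
    -- fat, hence equal, so a single vertex has all three labels.
    petersen⁻⇒petersen : ¬ ¬ (G ≅ petersen)
    petersen⁻⇒petersen ¬iso =
      outside-neighbour petersen⁻-sheltered-0 λ (v₀ , out₀ , ∈₀) →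
      outside-neighbour petersen⁻-sheltered-4 λ (v₄ , out₄ , ∈₄) →
      outside-neighbour petersen⁻-sheltered-8 λ (v₈ , out₈ , ∈₈) →
      ¬iso (completed out₀ (lookup≡ fat-all (fat-labels (outside⇒fat out₀)) ∈₀
        (subst (λ v → # 4 ∈ labels v) (fat-unique (outside⇒fat out₄) (outside⇒fat out₀)) ∈₄)
        (subst (λ v → # 8 ∈ labels v) (fat-unique (outside⇒fat out₈) (outside⇒fat out₀)) ∈₈)))

  -- Excluding θ⁺ when G is not the Petersen graph.

  module _ (¬petersen : ¬ (G ≅ petersen)) where

    no-antipode : (E : HasInduced G thetaPlus) (let open Embedded G thetaPlus E noOddHole) →
                  ∀ {v} → Outside v → labels v ≢ ⟦ # 1 ∷ # 5 ∷ [] ⟧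
    no-antipode E out eq =
      petersen⁻⇒petersen (Embedded.adjoinVertex G thetaPlus E noOddHole out eq) ¬petersen

    module _ (E : HasInduced G thetaPlus) where
      open Embedded G thetaPlus E noOddHole
      open Cuts G thetaPlus E noOddHole connected
      open FreeWalk

      rotated : HasInduced G thetaPlus
      rotated = restrict G thetaPlus (adj thetaPlus) E rotate-induces

      rotated-labels : ∀ v → labels v ≡ ⟦ # 3 ∷ # 7 ∷ [] ⟧ →
                       Embedded.labels G thetaPlus rotated noOddHole v ≡ ⟦ # 1 ∷ # 5 ∷ [] ⟧
      rotated-labels v eq = Vec.tabulate-cong λ i →
        ≡.trans (≡.sym (Vec.lookup∘tabulate (λ j → adj G v (f j)) (rotate i)))
                (cong (λ S → Vec.lookup S (rotate i)) eq)

      outside⇒free : ∀ v → Outside v → Free v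
      outside⇒free v out with theta-spread (labels v) (labels-spread no₃ no₄ out)
      ... | inj₁ thin = out , thin
      ... | inj₂ (here eq) = ⊥-elim (no-antipode E out eq)
      -- In the copy rotated by two, the labels v₃ and v₇ become v₁ and v₅.
      ... | inj₂ (there (here eq)) = ⊥-elim (no-antipode rotated (out ∘ rotate) (rotated-labels v eq))

      Through : Subset 8 → Set
      Through L = ∃ λ W → seen W ≡ L

      -- If the walks touched, merging them would give a free walk seeing `L ∪ M`, which no
      -- admissible set contains. So they are apart and `opposed` applies.
      not-both : ∀ {L M a b c d e} → Opposite thetaPlus L M a b e c d →
                 ¬ Any ((L ∪ M) ⊆_) thetaPlusParts → Through L → ¬ Through M
      not-both opp apart (W , refl) (W′ , refl) =
        opposed (walk W) (walk W′) (free W) (free W′) (λ p∈ q∈ → ¬link⇒apart G (unlinked p∈ q∈)) opp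
        where
        unlinked : ∀ {p q} → p ∈ˡ vertices W → q ∈ˡ vertices W′ → ¬ Link G p q
        unlinked p∈ q∈ l with zs , V , W⊆ , W′⊆ , ⊆W++W′ ← merge (walk W) (walk W′) p∈ q∈ l =
          apart (Any.map (λ ⊆part {i} i∈ → ⊆part
                    ([ labs-mono (vertices W) W⊆ , labs-mono (vertices W′) W′⊆ ]′
                      (x∈p∪q⁻ (seen W) (seen W′) i∈)))
                  (proj₁ (walk-admissible theta-base theta-growth V
                    (All.anti-mono ⊆W++W′ (All.++⁺ (free W) (free W′))))))

      -- An outside neighbour of `a` starts a free walk, which is enlarged while an unstable triple
      -- covers what it sees. The label `a` is kept throughout.
      quad-at : ∀ {a} → Sheltered thetaPlus a → ¬ ¬ ∃ λ L → a ∈ L × Any (L ≡_) quads × Through L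
      quad-at sh none =
        outside-neighbour sh λ (v , out , a∈) →
        saturate (covered₃? thetaPlus) grow (singleton (outside⇒free v out)) λ (W , sub , ¬c) →
        none (seen W , sub (p⊆p∪q _ a∈) , quad W ¬c , W , refl)
        where
        quad : ∀ W → ¬ Covered₃ thetaPlus (seen W) → Any (seen W ≡_) quads
        quad W ¬c = [ ⊥-elim ∘ ¬c , id ]′
          (theta-covered _ (walk-admissible theta-base theta-growth (walk W) (free W)))

        grow : ∀ W → Covered₃ thetaPlus (seen W) → ¬ ¬ ∃ λ W′ → seen W ⊂ seen W′
        grow W (x , y , xy , w , cover , t , t≢x , t≢y , t≢w) =
          enlarge (f w) xy (λ v → inj₁ ∘ outside⇒free v) (λ (out , _) → out w refl) t≢x t≢y
            (t≢w ∘ proj₁ (proj₂ E)) W (λ j → Sum.map id (Sum.map id (cong f)) ∘ cover j)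

      either : ∀ {a p q} → QuadsAt a p q →
               (∃ λ L → a ∈ L × Any (L ≡_) quads × Through L) → Through p ⊎ Through q
      either table (L , a∈ , quad , T) =
        Sum.map (λ eq → subst Through eq T) (λ eq → subst Through eq T) (lookup≡ table quad a∈)

      thetaPlus-free : ⊥
      thetaPlus-free =
        quad-at theta-sheltered-1 λ q₁ →
        quad-at theta-sheltered-3 λ q₃ →
        quad-at theta-sheltered-5 λ q₅ →
        quad-at theta-sheltered-7 λ q₇ →
        cases (either quads-at-1 q₁)
              (either quads-at-3 q₃)
              (either quads-at-5 q₅)
              (either quads-at-7 q₇)
        where
        not₀₂ : Through quad₀ → ¬ Through quad₂
        not₀₂ = not-both opposite₀₂ no-union₀₂

        not₁₃ : Through quad₁ → ¬ Through quad₃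
        not₁₃ = not-both opposite₁₃ no-union₁₃

        -- Without an opposite pair, at most two quads consecutive in cyclic order occur, and these
        -- miss one of v₁, v₃, v₅, v₇.
        cases : Through quad₀ ⊎ Through quad₃ → Through quad₀ ⊎ Through quad₁ →
                Through quad₁ ⊎ Through quad₂ → Through quad₂ ⊎ Through quad₃ → ⊥
        cases (inj₁ t₀) _ (inj₂ t₂) _ = not₀₂ t₀ t₂
        cases (inj₁ t₀) _ (inj₁ t₁) (inj₁ t₂) = not₀₂ t₀ t₂
        cases (inj₁ t₀) _ (inj₁ t₁) (inj₂ t₃) = not₁₃ t₁ t₃
        cases (inj₂ t₃) _ (inj₁ t₁) _ = not₁₃ t₁ t₃
        cases (inj₂ t₃) (inj₁ t₀) (inj₂ t₂) _ = not₀₂ t₀ t₂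
        cases (inj₂ t₃) (inj₂ t₁) (inj₂ t₂) _ = not₁₃ t₁ t₃

theorem1p6 : (n : ℕ) (G : Graph n) → ThreeConnected G → InG2 G →
    (∀ (X : Subset n) → IsThreeCutset G X → Stable G X) →
    ¬ (G ≅ petersen) → ¬ HasInduced G thetaPlus
theorem1p6 n G connected ((noCycle , _) , noOddHole) stable ¬petersen =
  thetaPlus-free (noCycle 3 ℕ.≤-refl (ℕ.m≤m+n 4 1) ∘ hole⇒cycle G)
          (noCycle 4 (ℕ.n≤1+n 3) ℕ.≤-refl ∘ hole⇒cycle G)
          noOddHole (edgeCutsConnected connected stable) ¬petersen
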